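{- Let $(G_1,\ldots,G_n)$ be a factorisation of a locally finite quasi-transitive connected graph $G$ (with more than one end). Then $$\operatorname{asdim}(G)\leq\max\big(\{1\}\cup\{\operatorname{asdim}(G_i)\mid 1\leq i\leq n\}\big).$$
   Context: **Conventions.** A group acts quasi-transitively on a graph if it acts by graph automorphisms with only finitely many orbits on vertices; a graph is quasi-transitive if some group acts quasi-transitively on it. A graph is regarded as a metric space with its graph distance. **Factorisation.** Let $G$ be a locally finite quasi-transitive connected graph with more than one end. A tuple $(G_1,\ldots,G_n)$ of locally finite quasi-transitive connected graphs is a factorisation of $G$ if $G$ is obtained by iterated non-trivial tree amalgamations of all $G_i$ of finite adhesion and finite identification respecting the group actions (that is, actions of groups acting quasi-transitively on the graphs being amalgamated). The terms are defined below. **Asymptotic dimension.** A cover $\mathcal V$ of a metric space $X$ is uniformly bounded if $\sup\{\operatorname{diam}(V)\mid V\in\mathcal V\}<\infty$. Its multiplicity is the smallest $n$ such that every $x\in X$ lies in at most $n$ elements of $\mathcal V$. A cover $\mathcal V$ refines a cover $\mathcal U$ if every $V\in\mathcal V$ is contained in some $U\in\mathcal U$. $X$ has asymptotic dimension at most $n$ if for every uniformly bounded open cover $\mathcal V$ of $X$ there is a uniformly bounded open cover $\mathcal U$ of $X$ of multiplicity at most $n+1$ such that $\mathcal V$ refines $\mathcal U$. $\operatorname{asdim}(X)$ is the least such $n$ ($\infty$ if there is none). **Tree amalgamation.** Let $I_1,I_2$ be disjoint sets and $G_1,G_2$ graphs. Let $(S^i_k)_{k\in I_i}$ be families of subsets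 of $V(G_i)$, $i=1,2$, all $S^i_k$ having the same cardinality. For all $k\in I_1,\ \ell\in I_2$ let $\phi_{k\ell}\colon S^1_k\to S^2_\ell$ be a bijection and put $\phi_{\ell k}=\phi_{k\ell}^{ -1}$; these are the bonding maps. Let $T$ be a tree with canonical bipartition $\{V_1,V_2\}$ such that all vertices in $V_i$ have degree $|I_i|$. Let $D(T)$ be the set of directed edges of $T$ (each edge $xy$ gives $\overrightarrow{xy}$ and $\overrightarrow{yx}$); for $\vec e=\overrightarrow{xy}$ write $\overleftarrow{e}=\overrightarrow{yx}$. Let $f\colon D(T)\to I_1\cup I_2$ be a labelling such that for every $i\in\{1,2\}$ and every $v\in V_i$ each $k\in I_i$ occurs precisely once among the labels of the directed edges starting at $v$. For $v\in V_i$ let $G_v$ be a copy of $G_i$, with $S^v_k$ the copy of $S^i_k$ in it. $G_1+G_2$ is the graph obtained from the disjoint union of all $G_v$, $v\in V(T)$, by adding, for every $\vec e=\overrightarrow{uv}$ with $f(\vec e)=k$, $f(\overleftarrow e)=\ell$, an edge between each $x\in S^u_k$ and $\phi_{k\ell}(x)\in S^v_\ell$. Contracting all edges of $G_1+G_2$ lying outside the copies $G_v$ gives the tree amalgamation $G_1\ast G_2=G_1\ast_T G_2$ over the connecting tree $T$. Let $\pi\colon V(G_1+G_2)\to V(G_1\ast G_2)$ be the canonical map sending each vertex to the vertex obtained from it after all contractions. The sets $S^i_k$ and their images under $\pi$ in $G_1\ast G_2$ are the adhesion sets. The tree amalgamation has finite adhesion if all its adhesion sets are finite. It is trivial if for some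 $v\in V(T)$ the restriction of $\pi$ to $V(G_v)$ is a bijection (onto $V(G_1\ast G_2)$), and non-trivial otherwise. For $x\in V(G_1\ast G_2)$ let $T_x$ be the maximal subtree of $T$ such that for each node $u$ of $T_x$ the graph $G_u$ contains a vertex $y$ with $\pi(y)=x$. The identification size of $x$ is $|V(T_x)|$. The tree amalgamation has finite identification if the identification sizes of all its vertices are bounded. **Respecting the actions.** Let $\Gamma_i$ be a group acting on $G_i$ for $i=1,2$, and let $\{i,j\}=\{1,2\}$. The tree amalgamation respects $\gamma\in\Gamma_i$ if there is a permutation $\sigma$ of $I_i$ such that for every $k\in I_i$ there exist $\ell\in I_j$ and $\tau$ in the setwise stabiliser of $S_\ell$ in $\Gamma_j$ such that $\phi_{k\ell}=\tau\circ\phi_{\sigma(k)\ell}\circ\gamma|_{S_k}$. It respects $\Gamma_i$ if it respects every $\gamma\in\Gamma_i$. For $k\in I_i$ and $\ell,\ell'\in I_j$, the bonding maps from $k$ to $\ell$ and $\ell'$ are consistent if there exists $\gamma\in\Gamma_j$ such that $\phi_{k\ell}=\gamma\circ\phi_{k\ell'}$. The bonding maps between $J_i\subseteq I_i$ and $J_j\subseteq I_j$ are consistent if they are consistent for all $k\in J_i$ and $\ell,\ell'\in J_j$. The tree amalgamation is of Type 1 respecting the actions of $\Gamma_1$ and $\Gamma_2$ if (i) it respects $\Gamma_1$ and $\Gamma_2$, and (ii) the bonding maps between $I_1$ and $I_2$ are consistent. It is of Type 2 respecting the actions of $\Gamma_1$ and $\Gamma_2$ if (o) $G_1=G_2$,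 $\Gamma_1=\Gamma_2=:\Gamma$ and $I_1=I_2=:I$ (formally one works with a bijection $I_1\to I_2$, since $I_1$ and $I_2$ are disjoint), and there exists $J\subseteq I$ such that $f(\vec e)\in J$ if and only if $f(\overleftarrow e)\notin J$; (i) it respects $\Gamma$; and (ii) the bonding maps between $J$ and $I\setminus J$ are consistent. The tree amalgamation respects the actions of $\Gamma_1$ and $\Gamma_2$ if it is of Type 1 or of Type 2 respecting these actions.
   Formalization: Every graph amalgamated at an intermediate step of the factorisation is also required to be connected; without this (empty adhesion sets allowed) one can pass through an infinite edgeless graph and build graphs of asymptotic dimension 2 from finite factors. -}

module Defs where

open import Algebra.Bundles using (Group)
open import Axiom.ExcludedMiddle using (ExcludedMiddle)
open import Data.Fin.Base using (Fin; zero; suc; inject₁; fromℕ)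
open import Data.List.Base using (List; []; _∷_; _++_; length)
open import Data.List.Membership.Propositional using (_∈_; _∉_)
open import Data.List.Relation.Unary.Any using (Any)
open import Data.Nat.Base as ℕ using (ℕ; zero; suc; _+_; _≤_; _<_; z≤n)
import Data.Nat.Properties as ℕₚ
open import Data.Nat.Induction using (<-rec)
open import Data.Product.Base using (Σ; Σ-syntax; ∃; ∃-syntax; _×_; _,_; proj₁; proj₂)
open import Data.Refinement.Base using (Refinement; Refinement-syntax; value)
open import Data.Sum.Base using (_⊎_; inj₁; inj₂)
open import Function.Base using (_∘_)
open import Function.Bundles using (_↔_; _⇔_; module Inverse)
open import Function.Definitions using (Injective; StrictlySurjective; Bijective)
open import Function.Metric.Nat.Bundles using (Metric)
open import Level using (Level; 0ℓ; Lift; lift; lower) renaming (suc to lsuc)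
open import Relation.Binary.Bundles using (TotalOrder)
open import Relation.Binary.Construct.Add.Supremum.NonStrict ℕ._≤_
  using (_≤⁺_; ≤⁺-isTotalOrder-≡)
open import Relation.Binary.Construct.Closure.Equivalence using (EqClosure)
open import Relation.Binary.Core using (Rel)
open import Relation.Binary.PropositionalEquality
  using (_≡_; _≢_; refl; cong₂; subst; isEquivalence)
open import Relation.Nullary.Construct.Add.Supremum using (_⁺; [_]; ⊤⁺)
open import Relation.Nullary.Decidable using (Dec; yes; no; map′)
open import Relation.Nullary.Negation using (¬_)
open import Relation.Unary using (Pred; U; ∁; _≐_; _⊆_)

private
  variable
    ℓ : Level

Finite : {A : Set} → Pred A ℓ → Set ℓ
Finite {A = A} P = Σ[ xs ∈ List A ] (∀ x → P x → x ∈ xs)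

AtMost : {A : Set} → ℕ → Pred A ℓ → Set ℓ
AtMost {A = A} m P = Σ[ xs ∈ List A ] (length xs ≤ m × (∀ x → P x → x ∈ xs))

IsLeast : (ℕ → Set ℓ) → ℕ → Set ℓ
IsLeast P n = P n × (∀ m → P m → n ≤ m)

least : ExcludedMiddle ℓ → (P : ℕ → Set ℓ) → ∃ P → ∃ (IsLeast P)
least {ℓ} em P (n , p) = <-rec (λ n → P n → ∃ (IsLeast P)) step n p
  where
  step : ∀ n → (∀ {m} → m < n → P m → ∃ (IsLeast P)) → P n → ∃ (IsLeast P)
  step n rec p with em {P = ∃[ m ] (m < n × P m)}
  ... | yes (m , m<n , q) = rec m<n q
  ... | no none = n , p , λ m q → ℕₚ.≮⇒≥ (λ m<n → none (m , m<n , q))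

lowerEM : ExcludedMiddle (lsuc 0ℓ) → ExcludedMiddle 0ℓ
lowerEM em {P} = map′ lower lift (em {P = Lift (lsuc 0ℓ) P})

record Graph : Set₁ where
  field
    V      : Set
    E      : Rel V 0ℓ
    E-sym  : ∀ {x y} → E x y → E y x
    E-irr  : ∀ {x} → ¬ E x x

open Graph

data Walk (G : Graph) : ℕ → V G → V G → Set where
  []  : ∀ {x} → Walk G 0 x x
  _∷_ : ∀ {n x y z} → E G x y → Walk G n y z → Walk G (suc n) x z

Joined : (G : Graph) → Rel (V G) 0ℓ
Joined G x y = ∃[ n ] Walk G n x y

Connected : Graph → Set
Connected G = V G × (∀ x y → Joined G x y)

LocallyFinite : Graph → Set
LocallyFinite G = ∀ x → Finite (E G x)

infix 6 _⟨_⟩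
_⟨_⟩ : (G : Graph) → Pred (V G) 0ℓ → Graph
G ⟨ P ⟩ = record
  { V     = [ x ∈ V G ∣ P x ]
  ; E     = λ x y → E G (value x) (value y)
  ; E-sym = E-sym G
  ; E-irr = E-irr G
  }

record Cycle (G : Graph) : Set where
  field
    excess : ℕ
    vertex : Fin (3 + excess) → V G
    inj    : Injective _≡_ _≡_ vertex
    step   : ∀ i → E G (vertex (inject₁ i)) (vertex (suc i))
    close  : E G (vertex (fromℕ (2 + excess))) (vertex zero)

IsTree : Graph → Set
IsTree T = Connected T × ¬ Cycle T

record Ray (G : Graph) : Set where
  field
    vertex : ℕ → V G
    inj    : Injective _≡_ _≡_ vertex
    step   : ∀ n → E G (vertex n) (vertex (suc n))

-- Two rays are equivalent if for every finite F they have tails in the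
-- same component of G - F.  The ends of G are the equivalence classes.
EquivalentRays : (G : Graph) → Rel (Ray G) 0ℓ
EquivalentRays G r s = (F : List (V G)) → ∃[ N ] (∀ m n → N ≤ m → N ≤ n →
  Σ[ x ∈ V (G ⟨ _∉ F ⟩) ] Σ[ y ∈ V (G ⟨ _∉ F ⟩) ]
    (value x ≡ Ray.vertex r m × value y ≡ Ray.vertex s n × Joined (G ⟨ _∉ F ⟩) x y))

MoreThanOneEnd : Graph → Set
MoreThanOneEnd G = Σ[ r ∈ Ray G ] Σ[ s ∈ Ray G ] (¬ EquivalentRays G r s)

record Action (Γ : Group 0ℓ 0ℓ) (G : Graph) : Set where
  private module Γ = Group Γ
  infixr 8 _·_
  field
    _·_    : Γ.Carrier → V G → V G
    ·-cong : ∀ {g h} → g Γ.≈ h → ∀ x → g · x ≡ h · x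
    ·-ε    : ∀ x → Γ.ε · x ≡ x
    ·-∙    : ∀ g h x → (g Γ.∙ h) · x ≡ g · h · x
    ·-E    : ∀ g {x y} → E G x y ⇔ E G (g · x) (g · y)

  FinitelyManyOrbits : Set
  FinitelyManyOrbits = Σ[ xs ∈ List (V G) ] (∀ y → Any (λ x → ∃[ g ] (g · x ≡ y)) xs)

  Stabilises : Γ.Carrier → Pred (V G) 0ℓ → Set
  Stabilises g P = ∀ x → P x ⇔ P (g · x)

QuasiTransitive : Graph → Set₁
QuasiTransitive G = Σ[ Γ ∈ Group 0ℓ 0ℓ ] Σ[ α ∈ Action Γ G ] Action.FinitelyManyOrbits α

record ActedGraph : Set₁ where
  field
    graph  : Graph
    group  : Group 0ℓ 0ℓ
    action : Action group graph

open ActedGraph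

data Side : Set where
  ① ② : Side

-- Opposite i j expresses {i , j} = {1 , 2}.
data Opposite : Rel Side 0ℓ where
  ①② : Opposite ① ②
  ②① : Opposite ② ①

flipped : ∀ {i j} → Opposite i j → Opposite j i
flipped ①② = ②①
flipped ②① = ①②

record TreeAmalgamation (G : Side → Graph) : Set₁ where
  field
    I : Side → Set
    S : ∀ {i} → I i → Pred (V (G i)) 0ℓ

  -- Membership proofs are irrelevant here, so _↔_ below is a bijection
  -- between subsets.
  Adh : ∀ {i} → I i → Set
  Adh {i} k = [ x ∈ V (G i) ∣ S k x ]

  field
    card    : ∀ {i j} (k : I i) (l : I j) → Adh k ↔ Adh l
    bonding : (k : I ①) (l : I ②) → Adh k ↔ Adh l
    -- The nodes on side i are the vertices in V_i.  Since every label at a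
    -- node v lies in I (side v), label-once makes label a bijection from the
    -- directed edges starting at v onto I (side v), so that v has degree
    -- |I (side v)|.
    T          : Graph
    tree       : IsTree T
    side       : V T → Side
    bipartite  : ∀ {u v} → E T u v → Opposite (side u) (side v)
    label      : ∀ {u v} → E T u v → I (side u)
    label-irr  : ∀ {u v} (e e′ : E T u v) → label e ≡ label e′
    label-once : ∀ u (k : I (side u)) →
                 Σ[ v ∈ V T ] (Σ[ e ∈ E T u v ] label e ≡ k) ×
                   (∀ w (e : E T u w) → label e ≡ k → w ≡ v)

  φ : ∀ {i j} → Opposite i j → (k : I i) (l : I j) → Adh k → Adh l
  φ ①② k l = Inverse.to   (bonding k l)
  φ ②① k l = Inverse.from (bonding l k)

  V⁺ : Set
  V⁺ = Σ[ v ∈ V T ] V (G (side v))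

  data Inner : Rel V⁺ 0ℓ where
    inner : ∀ {v x y} → E (G (side v)) x y → Inner (v , x) (v , y)

  -- e and e′ are the two directions of the same edge of T.
  data Cross : Rel V⁺ 0ℓ where
    cross : ∀ {u v} (e : E T u v) (e′ : E T v u) (o : Opposite (side u) (side v))
            (x : Adh (label e)) →
            Cross (u , value x) (v , value (φ o (label e) (label e′) x))

  private
    φ-flip : ∀ {i j} (o : Opposite i j) (k : I i) (l : I j) x →
             φ (flipped o) l k (φ o k l x) ≡ x
    φ-flip ①② k l x = Inverse.strictlyInverseʳ (bonding k l) x
    φ-flip ②① k l x = Inverse.strictlyInverseˡ (bonding l k) x

    Inner-sym : ∀ {p q} → Inner p q → Inner q p
    Inner-sym (inner {v} e) = inner (E-sym (G (side v)) e)

    Cross-sym : ∀ {p q} → Cross p q → Cross q p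
    Cross-sym (cross {u} {v} e e′ o x) =
      subst (λ y → Cross (v , value z) (u , value y)) (φ-flip o (label e) (label e′) x)
            (cross e′ e (flipped o) z)
      where z = φ o (label e) (label e′) x

    Inner-irr : ∀ {p q} → Inner p q → p ≢ q
    Inner-irr (inner {v} e) refl = E-irr (G (side v)) e

    Cross-irr : ∀ {p q} → Cross p q → proj₁ p ≢ proj₁ q
    Cross-irr (cross e e′ o x) refl = E-irr T e

  -- The graph G₁ + G₂.
  Plus : Graph
  Plus = record
    { V     = V⁺
    ; E     = λ p q → Inner p q ⊎ Cross p q
    ; E-sym = λ where
        (inj₁ e) → inj₁ (Inner-sym e)
        (inj₂ e) → inj₂ (Cross-sym e)
    ; E-irr = λ where
        (inj₁ e) → Inner-irr e refl
        (inj₂ e) → Cross-irr e refl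
    }

  -- The adhesion sets of the amalgam itself are images of these.
  FiniteAdhesion : Set
  FiniteAdhesion = ∀ {i} (k : I i) → Finite (S k)

-- K, with canonical map π, is the (simple) graph obtained from H by
-- contracting the edges in F.  Agda having no quotient types, this pins
-- down K only up to isomorphism.
record IsContraction (H : Graph) (F : Rel (V H) 0ℓ)
                     (K : Graph) (π : V H → V K) : Set where
  field
    surjective : StrictlySurjective _≡_ π
    identifies : ∀ x y → π x ≡ π y ⇔ EqClosure F x y
    adjacency  : ∀ u v → E K u v ⇔
      (u ≢ v × ∃[ x ] ∃[ y ] (E H x y × π x ≡ u × π y ≡ v))

module _ {G : Side → Graph} (A : TreeAmalgamation G) where
  open TreeAmalgamation A

  module _ (K : Graph) (π : V Plus → V K) where

    IsAmalgam : Set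
    IsAmalgam = IsContraction Plus Cross K π

    Trivial : Set
    Trivial = Σ[ v ∈ V T ] Bijective _≡_ _≡_ (λ (x : V (G (side v))) → π (v , x))

    -- P is the set of nodes of a subtree of T each of whose copies meets
    -- the fibre of π over x.
    SubtreeOver : V K → Pred (V T) 0ℓ → Set
    SubtreeOver x P = Connected (T ⟨ P ⟩) × (∀ u → P u → ∃[ y ] (π (u , y) ≡ x))

    IsTₓ : V K → Pred (V T) 0ℓ → Set₁
    IsTₓ x P = SubtreeOver x P × (∀ Q → SubtreeOver x Q → P ⊆ Q → Q ⊆ P)

    FiniteIdentification : Set₁
    FiniteIdentification = ∃[ m ] (∀ x P → IsTₓ x P → AtMost m P)

module _ (X : Side → ActedGraph) (A : TreeAmalgamation (graph ∘ X)) where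
  open TreeAmalgamation A
  private
    module Γ (i : Side) = Group (group (X i))
    module α {i : Side} = Action (action (X i))
  open α

  -- x′ is γ x, regarded as an element of S (σ k).
  RespectsElement : ∀ {i j} → Opposite i j → Γ.Carrier i → Set
  RespectsElement {i} {j} o γ =
    Σ[ σ ∈ I i ↔ I i ] (∀ k → Σ[ l ∈ I j ] Σ[ τ ∈ Γ.Carrier j ]
      (Stabilises τ (S l) ×
       (∀ (x : Adh k) → Σ[ x′ ∈ Adh (Inverse.to σ k) ]
          (value x′ ≡ γ · value x ×
           value (φ o k l x) ≡ τ · value (φ o (Inverse.to σ k) l x′)))))

  RespectsGroups : Set
  RespectsGroups = ∀ {i j} (o : Opposite i j) (γ : Γ.Carrier i) → RespectsElement o γ

  ConsistentAt : ∀ {i j} → Opposite i j → I i → I j → I j → Set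
  ConsistentAt {j = j} o k l l′ =
    Σ[ γ ∈ Γ.Carrier j ] (∀ x → value (φ o k l x) ≡ γ · value (φ o k l′ x))

  onSides : Pred (I ①) 0ℓ → Pred (I ②) 0ℓ → ∀ i → Pred (I i) 0ℓ
  onSides P Q ① = P
  onSides P Q ② = Q

  Consistent : Pred (I ①) 0ℓ → Pred (I ②) 0ℓ → Set
  Consistent P Q = ∀ {i j} (o : Opposite i j) {k l l′} →
    onSides P Q i k → onSides P Q j l → onSides P Q j l′ → ConsistentAt o k l l′

  Type1 : Set
  Type1 = RespectsGroups × Consistent U U

  -- ι identifies I₁ with I₂, so a subset J of I₁ = I₂ is a subset of either
  -- index set.  "Between J and I ∖ J" covers J taken in I₁ (with I ∖ J
  -- taken in I₂) as well as J taken in I₂.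
  record Type2 : Set₁ where
    field
      same : X ① ≡ X ②
      ι    : I ① ↔ I ②
      J    : Pred (I ①) 0ℓ

    J′ : Pred (I ②) 0ℓ
    J′ = J ∘ Inverse.from ι

    field
      exactlyOne  : ∀ {u v} (e : E T u v) (e′ : E T v u) →
                    onSides J J′ (side u) (label e) ⇔
                      (¬ onSides J J′ (side v) (label e′))
      respects    : RespectsGroups
      consistent₁ : Consistent J (∁ J′)
      consistent₂ : Consistent (∁ J) J′

  RespectsActions : Set₁
  RespectsActions = Type1 ⊎ Type2

-- Obtained Gs is K: K arises by iterated tree amalgamations starting from
-- the graphs Gs i; is lists the indices of the starting graphs used.
data Obtained {n} (Gs : Fin n → Graph) : List (Fin n) → Graph → Set₁ where
  factor  : ∀ i → Obtained Gs (i ∷ []) (Gs i)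
  amalgam : ∀ {is js K} (X : Side → ActedGraph) →
            Obtained Gs is (graph (X ①)) → Obtained Gs js (graph (X ②)) →
            (∀ i → LocallyFinite (graph (X i)) × Connected (graph (X i)) ×
                   Action.FinitelyManyOrbits (action (X i))) →
            (A : TreeAmalgamation (graph ∘ X)) →
            (π : V (TreeAmalgamation.Plus A) → V K) → IsAmalgam A K π →
            ¬ Trivial A K π →
            TreeAmalgamation.FiniteAdhesion A →
            FiniteIdentification A K π →
            RespectsActions X A →
            Obtained Gs (is ++ js) K

record Factorisation (G : Graph) {n} (Gs : Fin n → Graph) : Set₁ where
  field
    locallyFinite   : ∀ i → LocallyFinite (Gs i)
    quasiTransitive : ∀ i → QuasiTransitive (Gs i)
    connected       : ∀ i → Connected (Gs i)
    used            : List (Fin n)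
    obtained        : Obtained Gs used G
    all-used        : ∀ i → i ∈ used

module _ {G : Graph} where

  _++ʷ_ : ∀ {m n x y z} → Walk G m x y → Walk G n y z → Walk G (m + n) x z
  []      ++ʷ w = w
  (e ∷ v) ++ʷ w = e ∷ (v ++ʷ w)

  reverseʷ : ∀ {n x y} → Walk G n x y → Walk G n y x
  reverseʷ [] = []
  reverseʷ {suc n} {x} {y} (e ∷ w) =
    subst (λ m → Walk G m y x) (ℕₚ.+-comm n 1) (reverseʷ w ++ʷ (E-sym G e ∷ []))

module _ (em : ExcludedMiddle 0ℓ) (G : Graph) (conn : Connected G) where

  private
    shortest : ∀ x y → ∃ (IsLeast (λ n → Walk G n x y))
    shortest x y = least em _ (proj₂ conn x y)

  dist : V G → V G → ℕ
  dist x y = proj₁ (shortest x y)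

  private
    walk : ∀ x y → Walk G (dist x y) x y
    walk x y = proj₁ (proj₂ (shortest x y))

    minimal : ∀ {x y n} → Walk G n x y → dist x y ≤ n
    minimal {x} {y} w = proj₂ (proj₂ (shortest x y)) _ w

    length0 : ∀ {n x y} → n ≡ 0 → Walk G n x y → x ≡ y
    length0 refl [] = refl

  metric : Metric 0ℓ 0ℓ
  metric = record
    { Carrier  = V G
    ; _≈_      = _≡_
    ; d        = dist
    ; isMetric = record
      { isSemiMetric = record
        { isQuasiSemiMetric = record
          { isPreMetric = record
            { isProtoMetric = record
              { isPartialOrder  = ℕₚ.≤-isPartialOrder
              ; ≈-isEquivalence = isEquivalence
              ; cong            = cong₂ dist
              ; nonNegative     = z≤n
              }
            ; ≈⇒0 = λ { refl → ℕₚ.n≤0⇒n≡0 (minimal []) }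
            }
          ; 0⇒≈ = λ {x} {y} eq → length0 eq (walk x y)
          }
        ; sym = λ x y → ℕₚ.≤-antisym (minimal (reverseʷ (walk y x)))
                                     (minimal (reverseʷ (walk x y)))
        }
      ; triangle = λ x y z → minimal (walk x y ++ʷ walk y z)
      }
    }

module _ (M : Metric 0ℓ 0ℓ) where
  open Metric M using (Carrier; d)

  -- As the metric is ℕ-valued, natural radii suffice.
  IsOpen : Pred Carrier 0ℓ → Set
  IsOpen P = ∀ x → P x → ∃[ r ] (0 < r × (∀ y → d x y < r → P y))

  -- The cover is the set { member i | i ∈ Index } of subsets.
  record OpenCover : Set₁ where
    field
      Index  : Set
      member : Index → Pred Carrier 0ℓ
      isOpen : ∀ i → IsOpen (member i)
      covers : ∀ x → ∃[ i ] member i x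

  open OpenCover

  UniformlyBounded : OpenCover → Set
  UniformlyBounded 𝒰 = ∃[ D ] (∀ i x y → member 𝒰 i x → member 𝒰 i y → d x y ≤ D)

  -- Elements of the cover are counted as subsets: indices naming the same
  -- subset are not distinguished.
  MultiplicityAtMost : ℕ → OpenCover → Set
  MultiplicityAtMost m 𝒰 = ∀ x → Σ[ js ∈ List (Index 𝒰) ] (length js ≤ m ×
    (∀ i → member 𝒰 i x → Any (λ j → member 𝒰 i ≐ member 𝒰 j) js))

  Refines : OpenCover → OpenCover → Set
  Refines 𝒱 𝒰 = ∀ i → ∃[ j ] (member 𝒱 i ⊆ member 𝒰 j)

  AsdimAtMost : ℕ → Set₁
  AsdimAtMost n = ∀ 𝒱 → UniformlyBounded 𝒱 → Σ[ 𝒰 ∈ OpenCover ]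
    (UniformlyBounded 𝒰 × MultiplicityAtMost (suc n) 𝒰 × Refines 𝒱 𝒰)

  asdimᴹ : ExcludedMiddle (lsuc 0ℓ) → ℕ ⁺
  asdimᴹ em with em {P = ∃ AsdimAtMost}
  ... | yes ex = [ proj₁ (least em AsdimAtMost ex) ]
  ... | no  _  = ⊤⁺

-- Classical logic is what makes the distance and the asymptotic dimension,
-- both defined as minima, total functions.
asdim : ExcludedMiddle (lsuc 0ℓ) → (G : Graph) → Connected G → ℕ ⁺
asdim em G conn = asdimᴹ (metric (lowerEM em) G conn) em

-- ℕ ∪ {∞}, with ∞ = ⊤⁺.
ℕ⁺-totalOrder : TotalOrder 0ℓ 0ℓ 0ℓ
ℕ⁺-totalOrder = record { isTotalOrder = ≤⁺-isTotalOrder-≡ ℕₚ.≤-isTotalOrder }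

{-# OPTIONS --safe #-}
module Submission where

open import Defs
open import Axiom.ExcludedMiddle using (ExcludedMiddle)
open import Data.Empty using (⊥; ⊥-elim)
open import Data.Fin.Base as Fin using (Fin; zero; suc; toℕ)
import Data.Fin.Properties as Finₚ
open import Data.Irrelevant using ([_])
open import Data.List.Base using (List; []; _∷_; length; tabulate; lookup)
open import Data.List.Extrema ℕ⁺-totalOrder using (max; ⊥≤max; xs≤max)
open import Data.List.Membership.Propositional using (_∈_)
open import Data.List.Properties using (length-tabulate)
import Data.List.Relation.Unary.All.Properties as Allₚ
import Data.List.Relation.Unary.Any as Any
open Any using (Any)
import Data.List.Relation.Unary.Any.Properties as Anyₚ
open import Data.Nat.Base using (ℕ; zero; suc; _+_; _*_; _∸_; _≤_; _<_; z≤n; s≤s; z<s)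
open import Data.Nat.Properties
open import Data.Product.Base using (Σ-syntax; ∃; ∃-syntax; _×_; _,_; proj₁; proj₂)
open import Data.Refinement.Base using (value; _,_)
open import Data.Refinement.Properties using (value-injective)
open import Data.Sum.Base using (_⊎_; inj₁; inj₂)
open import Function.Base using (_∘_)
open import Function.Bundles using (module Inverse; module Equivalence; _⇔_)
open import Function.Metric.Nat.Bundles using (Metric)
import Level
open import Level using (0ℓ)
open import Relation.Binary.Construct.Add.Supremum.NonStrict _≤_ using (_≤⁺_; _≤⊤⁺; [_])
open import Relation.Binary.Construct.Closure.Equivalence using (EqClosure)
open import Relation.Binary.Construct.Closure.ReflexiveTransitive using (Star; ε; _◅_; _◅◅_; reverse)
open import Relation.Binary.Construct.Closure.Symmetric using (SymClosure; fwd; bwd)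
open import Relation.Binary.Core using (Rel)
open import Relation.Binary.Definitions using (tri<; tri≈; tri>)
open import Relation.Binary.PropositionalEquality
  using (_≡_; _≢_; refl; sym; trans; cong; subst; subst₂)
open import Relation.Nullary.Construct.Add.Supremum using ([_]; ⊤⁺)
open import Relation.Nullary.Decidable using (Dec; yes; no; decidable-stable; recompute)
open import Relation.Nullary.Negation using (¬_)
open import Relation.Unary using (Pred; _≐_; _⊆_; ∁)

open Graph

-- A graph has asymptotic dimension at most n iff for every r it can be coloured with n + 1
-- colours so that monochromatic r-chains are uniformly bounded.  For a tree amalgamation,
-- finite identification makes the contraction G₁ + G₂ → G₁ * G₂ a quasi-isometry, so it
-- suffices to colour G₁ + G₂, which is a tree of copies of G₁ and G₂.  Consistency of the
-- bonding maps bounds the diameters of the adhesion sets, so each copy is a Lipschitz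
-- retract, and what lies below a node is reached only near one point, the gate of the node.
-- Blocks of bounded tree depth are coloured by induction on the depth: near its gate a
-- child subtree takes over the colour of the gate, elsewhere it has a colouring of its own,
-- and the parent is coloured at a much larger scale.  To pass to unbounded depth, cut the
-- tree into blocks of fixed depth and surround each gate by two layers, the first in the
-- colour of the gate and the second in another one (n ≥ 1 is used here); then
-- monochromatic chains do not pass from one block into the next.

-- Covers and colourings

module _ (G : Graph) where

  -- Stated with walks instead of `dist`, so that neither connectedness nor excluded middle is
  -- involved.
  Near : ℕ → Rel (V G) 0ℓ
  Near r x y = ∃[ n ] (n ≤ r × Walk G n x y)

  Link : ℕ → Pred (V G) 0ℓ → Rel (V G) 0ℓ
  Link r P x y = P x × P y × Near r x y

  -- The `r`-components of `P` have diameter at most `R`, measured in `G` and not within `P`.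
  Bounded : ℕ → ℕ → Pred (V G) 0ℓ → Set
  Bounded R r P = ∀ {x y} → Star (Link r P) x y → Near R x y

  Colourable : ℕ → Set
  Colourable n = ∀ r → ∃[ R ] Σ[ c ∈ (V G → Fin (suc n)) ] (∀ i → Bounded R r (λ x → c x ≡ i))

module _ {G : Graph} where

  near-refl : ∀ {r x} → Near G r x x
  near-refl = 0 , z≤n , []

  near-edge : ∀ {x y} → E G x y → Near G 1 x y
  near-edge e = 1 , ≤-refl , e ∷ []

  near-sym : ∀ {r x y} → Near G r x y → Near G r y x
  near-sym (n , n≤r , w) = n , n≤r , reverseʷ w

  near-trans : ∀ {r s x y z} → Near G r x y → Near G s y z → Near G (r + s) x z
  near-trans (m , m≤r , v) (n , n≤s , w) = m + n , +-mono-≤ m≤r n≤s , v ++ʷ w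

  near-mono : ∀ {r s x y} → r ≤ s → Near G r x y → Near G s x y
  near-mono r≤s (n , n≤r , w) = n , ≤-trans n≤r r≤s , w

  link-sym : ∀ {r P x y} → Link G r P x y → Link G r P y x
  link-sym (px , py , d) = py , px , near-sym d

  chain-sym : ∀ {r P x y} → Star (Link G r P) x y → Star (Link G r P) y x
  chain-sym {P = P} = reverse (link-sym {P = P})

  chain-end : ∀ {r P x y} → P x → Star (Link G r P) x y → P y
  chain-end px ε = px
  chain-end px ((_ , pz , _) ◅ ls) = chain-end pz ls

module _ (em : ExcludedMiddle 0ℓ) (G : Graph) (conn : Connected G) where
  private
    M = metric em G conn
    d = dist em G conn

  geodesic : ∀ x y → IsLeast (λ n → Walk G n x y) (d x y)
  geodesic x y = proj₂ (least em (λ n → Walk G n x y) (proj₂ conn x y))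

  dist⇒near : ∀ {r x y} → d x y ≤ r → Near G r x y
  dist⇒near d≤r = _ , d≤r , proj₁ (geodesic _ _)

  near⇒dist : ∀ {r x y} → Near G r x y → d x y ≤ r
  near⇒dist (n , n≤r , w) = ≤-trans (proj₂ (geodesic _ _) n w) n≤r

  -- Distances are natural numbers, so an open ball of radius 1 is a single point.
  all-open : ∀ P → IsOpen M P
  all-open P x px = 1 , s≤s z≤n , λ y d<1 →
    subst P (Metric.0⇒≈ M (n<1⇒n≡0 d<1)) px

  open OpenCover

  ball-cover : ℕ → OpenCover M
  ball-cover t = record
    { Index = V G ; member = Near G t
    ; isOpen = λ x → all-open _ ; covers = λ x → x , near-refl }

  -- If B(x, s r) ⊆ U forces B(x, (s + 1) r) ⊆ U for all U in the cover, then x may get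
  -- colour s: the family of those U does not change along an r-chain of colour s.  As
  -- x lies in at most n + 1 members, the n + 2 radii 0, r, ..., (n + 1) r cannot all
  -- give different families, so some colour is available.
  asdim⇒colourable : ∀ {n} → AsdimAtMost M n → Colourable G n
  asdim⇒colourable {n} asd r with asd (ball-cover (suc n * r)) (suc n * r + suc n * r , ball-bounded)
    where
    ball-bounded : ∀ i x y → Near G (suc n * r) i x → Near G (suc n * r) i y →
                   d x y ≤ suc n * r + suc n * r
    ball-bounded i x y a b = near⇒dist (near-trans (near-sym a) b)
  ... | 𝒰 , (D , bdd) , mult , ref = D , proj₁ ∘ colour , λ i → bound i (λ x → colour x)
    where
    Inside : ℕ → V G → Index 𝒰 → Set
    Inside s x U = ∀ y → Near G (s * r) x y → member 𝒰 U y

    Good : V G → Fin (suc n) → Set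
    Good x i = ∀ U → Inside (toℕ i) x U → Inside (suc (toℕ i)) x U

    inside-mono : ∀ {s t x U} → s ≤ t → Inside t x U → Inside s x U
    inside-mono s≤t ins y yx = ins y (near-mono (*-monoˡ-≤ r s≤t) yx)

    start : ∀ x → ∃[ U ] Inside (suc n) x U
    start x = proj₁ (ref x) , λ y → proj₂ (ref x)

    colour : ∀ x → ∃ (Good x)
    colour x with em {P = ∃ (Good x)}
    ... | yes good = good
    ... | no none =
      let i , j , i<j , eq = Finₚ.pigeonhole (s≤s (proj₁ (proj₂ (mult x)))) (Any.index ∘ slot)
      in ⊥-elim (clash i j i<j eq)
      where
      last : ∀ (j : Fin (suc (suc n))) → (∃[ i ] toℕ i ≡ toℕ j) ⊎ toℕ j ≡ suc n
      last j with toℕ j <? suc n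
      ... | yes j<n = inj₁ (Fin.fromℕ< j<n , Finₚ.toℕ-fromℕ< j<n)
      ... | no j≮n = inj₂ (≤-antisym (≤-pred (Finₚ.toℕ<n j)) (≮⇒≥ j≮n))

      Stage : ℕ → Index 𝒰 → Set
      Stage j U = Inside j x U × (j < suc n → ¬ Inside (suc j) x U)

      fails : ∀ (i : Fin (suc n)) → ∃ (Stage (toℕ i))
      fails i with em {P = ∃ (Stage (toℕ i))}
      ... | yes ex = ex
      ... | no nex = ⊥-elim (none (i , λ U ins →
                       decidable-stable em λ ¬ins → nex (U , ins , λ _ → ¬ins)))

      level : ∀ (j : Fin (suc (suc n))) → ∃ (Stage (toℕ j))
      level j with last j
      ... | inj₁ (i , eq) = subst (∃ ∘ Stage) eq (fails i)
      ... | inj₂ eq = subst (∃ ∘ Stage) (sym eq)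
                        (proj₁ (start x) , proj₂ (start x) , λ lt → ⊥-elim (<-irrefl refl lt))

      js = proj₁ (mult x)

      slot : ∀ j → Any (λ U → member 𝒰 (proj₁ (level j)) ≐ member 𝒰 U) js
      slot j = proj₂ (proj₂ (mult x)) _ (proj₁ (proj₂ (level j)) x near-refl)

      clash : ∀ i j → i Fin.< j → ¬ Any.index (slot i) ≡ Any.index (slot j)
      -- With equal slots the two sets would coincide, but the set of stage `j` contains the ball of
      -- radius (i + 1) r about `x` and that of stage `i` does not.
      clash i j i<j eq =
        proj₂ (proj₂ (level i)) (≤-trans i<j (≤-pred (Finₚ.toℕ<n j))) λ y yx →
          proj₂ (Anyₚ.lookup-index (slot i))
            (subst (λ k → member 𝒰 (lookup js k) y) (sym eq)
              (proj₁ (Anyₚ.lookup-index (slot j))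
                (inside-mono i<j (proj₁ (proj₂ (level j))) y yx)))

    bound : ∀ i (c : ∀ x → ∃ (Good x)) → Bounded G D r (λ x → proj₁ (c x) ≡ i)
    bound i c {x} {y} ε = near-refl
    bound i c {x} {y} ls@((refl , _) ◅ _) with start x
    ... | U , ins = dist⇒near (bdd U x y (ins x near-refl)
        (transport ls (inside-mono (Finₚ.toℕ<n (proj₁ (c x))) ins) y near-refl))
      where
      transport : ∀ {z y} → Star (Link G r (λ x′ → proj₁ (c x′) ≡ proj₁ (c x))) z y →
                  Inside (suc (toℕ (proj₁ (c x)))) z U → Inside (suc (toℕ (proj₁ (c x)))) y U
      transport ε ins = ins
      transport {z} ((_ , cz , near) ◅ ls) ins = transport ls
        (subst (λ k → Inside (suc (toℕ k)) _ U) cz (proj₂ (c _) U λ y zy →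
          ins y (near-trans near (subst (λ k → Near G (toℕ k * r) _ y) cz zy))))

  -- Thicken the monochromatic `B + B`-components by `B`. If two thickened components of one colour
  -- meet, then the components are linked and coincide, so each point lies in at most one per
  -- colour.
  colourable⇒asdim : ∀ {n} → Colourable G n → AsdimAtMost M n
  colourable⇒asdim {n} col 𝒱 (B , bdd) with col (B + B)
  ... | R , c , bounded = 𝒰 , (B + (R + B) , 𝒰-bounded) , multiplicity , refines
    where
    Comp : V G → V G → Set
    Comp x = Star (Link G (B + B) (λ y → c y ≡ c x)) x

    Member : V G → V G → Set
    Member x y = ∃[ z ] (Comp x z × Near G B z y)

    𝒰 : OpenCover M
    𝒰 = record { Index = V G ; member = Member ; isOpen = λ x → all-open _
               ; covers = λ x → x , x , ε , near-refl }

    𝒰-bounded : ∀ i x y → Member i x → Member i y → d x y ≤ B + (R + B)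
    𝒰-bounded i x y (z , iz , zx) (z′ , iz′ , z′y) =
      near⇒dist (near-trans (near-sym zx)
        (near-trans (bounded (c i) (chain-sym {P = λ y → c y ≡ c i} iz ◅◅ iz′)) z′y))

    joins : ∀ {i j x} → c i ≡ c j → Member i x → Member j x → Member i ⊆ Member j
    joins {i} {j} same (z , iz , zx) (z′ , jz′ , z′x) (w , iw , wy) =
      w , jz′ ◅◅
          ((chain-end {P = Q} refl jz′ , trans (chain-end {P = Q′} refl iz) same ,
              near-trans z′x (near-sym zx))
          ◅ subst (λ k → Star (Link G (B + B) (λ y → c y ≡ k)) z w) same
              (chain-sym {P = Q′} iz ◅◅ iw)) , wy
      where
      Q Q′ : V G → Set
      Q y = c y ≡ c j
      Q′ y = c y ≡ c i

    pick : V G → Fin (suc n) → V G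
    pick y k with em {P = ∃[ x ] (c x ≡ k × Member x y)}
    ... | yes (x , _) = x
    -- A default value: surplus entries in the list do no harm.
    ... | no _ = y

    pick-spec : ∀ x y → Member x y → c (pick y (c x)) ≡ c x × Member (pick y (c x)) y
    pick-spec x y m with em {P = ∃[ x′ ] (c x′ ≡ c x × Member x′ y)}
    ... | yes (_ , spec) = spec
    ... | no none = ⊥-elim (none (x , refl , m))

    multiplicity : MultiplicityAtMost M (suc n) 𝒰
    multiplicity y = tabulate (pick y) , ≤-reflexive (length-tabulate (pick y)) , λ x m →
      let same , m′ = pick-spec x y m in
      Anyₚ.tabulate⁺ {f = pick y} (c x) (joins (sym same) m m′ , joins same m′ m)

    refines : Refines M 𝒱 𝒰
    refines i with em {P = ∃ (member 𝒱 i)}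
    ... | yes (v , mv) = v , λ {y} my → v , ε , dist⇒near (bdd i v y mv my)
    -- An empty member is contained in any set.
    ... | no none = proj₁ conn , λ {y} my → ⊥-elim (none (y , my))

-- Trees of spaces

record RootedTree : Set₁ where
  field
    Node         : Set
    root         : Node
    parent       : Node → Node
    depth        : Node → ℕ
    depth-parent : ∀ v → 0 < depth v → depth v ≡ suc (depth (parent v))
    depth-root   : ∀ v → depth v ≡ 0 → v ≡ root

  infix 4 _◁_ _⊑_

  _◁_ : Rel Node 0ℓ
  u ◁ v = parent u ≡ v × depth u ≡ suc (depth v)

  data _⊑_ : Rel Node 0ℓ where
    here : ∀ {v} → v ⊑ v
    up   : ∀ {u v w} → u ◁ v → v ⊑ w → u ⊑ w

  ◁-parent : ∀ {v} → 0 < depth v → v ◁ parent v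
  ◁-parent 0<d = refl , depth-parent _ 0<d

  ⊑-trans : ∀ {u v w} → u ⊑ v → v ⊑ w → u ⊑ w
  ⊑-trans here v⊑w = v⊑w
  ⊑-trans (up u◁ ⊑v) v⊑w = up u◁ (⊑-trans ⊑v v⊑w)

  ⊑-depth : ∀ {v w} → v ⊑ w → depth w ≤ depth v
  ⊑-depth here = ≤-refl
  ⊑-depth (up (_ , eq) ⊑w) = ≤-trans (⊑-depth ⊑w) (≤-trans (n≤1+n _) (≤-reflexive (sym eq)))

  ⊑-child : ∀ {v w} → v ⊑ w → v ≡ w ⊎ ∃[ a ] (a ◁ w × v ⊑ a)
  ⊑-child here = inj₁ refl
  ⊑-child (up v◁u u⊑w) with ⊑-child u⊑w
  ... | inj₁ refl = inj₂ (_ , v◁u , here)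
  ... | inj₂ (a , a◁w , u⊑a) = inj₂ (a , a◁w , up v◁u u⊑a)

  ⊑-parent : ∀ {u v w} → u ⊑ w → u ◁ v → u ≡ w ⊎ v ⊑ w
  ⊑-parent here _ = inj₁ refl
  ⊑-parent (up (refl , _) ⊑w) (refl , _) = inj₂ ⊑w

  ⊑-linear : ∀ {u v w} → u ⊑ v → u ⊑ w → depth w ≤ depth v → v ⊑ w
  ⊑-linear here u⊑w _ = u⊑w
  ⊑-linear (up u◁u′ u′⊑v) u⊑w w≤v with ⊑-parent u⊑w u◁u′
  ... | inj₂ u′⊑w = ⊑-linear u′⊑v u′⊑w w≤v
  ... | inj₁ refl = ⊥-elim (<-irrefl refl
          (≤-trans (≤-reflexive (sym (proj₂ u◁u′))) (≤-trans w≤v (⊑-depth u′⊑v))))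

  ⊑-unique : ∀ {u v w} → u ⊑ v → u ⊑ w → depth v ≡ depth w → v ≡ w
  ⊑-unique u⊑v u⊑w eq with ⊑-linear u⊑v u⊑w (≤-reflexive (sym eq))
  ... | here = refl
  ... | up (_ , eq′) ⊑w = ⊥-elim (<-irrefl refl
          (≤-trans (s≤s (⊑-depth ⊑w)) (≤-reflexive (trans (sym eq′) eq))))

  ⊑-root : ∀ v → v ⊑ root
  ⊑-root v = go (depth v) v refl
    where
    go : ∀ n v → depth v ≡ n → v ⊑ root
    go zero v eq = subst (v ⊑_) (depth-root v eq) here
    go (suc n) v eq =
      up v◁ (go n (parent v) (suc-injective (trans (sym (proj₂ v◁)) eq)))
      where v◁ = ◁-parent (subst (0 <_) (sym eq) (s≤s z≤n))

  module Levels (m : ℕ) (0<m : 0 < m) where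

    Cut : Node → Set
    Cut b = ∃[ k ] depth b ≡ k * m

    -- The depth condition makes `b` the deepest cut node above `v`, the top of the block of `v`.
    Home : Node → Node → Set
    Home v b = Cut b × v ⊑ b × depth v < m + depth b

    cut-gap : ∀ {b b′} → Cut b → Cut b′ → depth b < depth b′ → m + depth b ≤ depth b′
    cut-gap (k , eq) (k′ , eq′) b<b′ =
      subst₂ (λ x y → m + x ≤ y) (sym eq) (sym eq′)
        (*-monoˡ-≤ m (*-cancelʳ-< m k k′ (subst₂ _<_ eq eq′ b<b′)))

    cut-≤ : ∀ {b b′} → Cut b → Cut b′ → depth b < m + depth b′ → depth b ≤ depth b′
    cut-≤ cut cut′ lt = ≮⇒≥ λ b′<b → <⇒≱ lt (cut-gap cut′ cut b′<b)

    home : ∀ v → ∃ (Home v)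
    home v = go (depth v) v refl
      where
      go : ∀ n v → depth v ≡ n → ∃ (Home v)
      go zero v eq = v , (0 , eq) , here , m<n+m (depth v) 0<m
      go (suc n) v eq with go n (parent v) (suc-injective (trans (sym (proj₂ v◁)) eq))
        where v◁ = ◁-parent {v} (subst (0 <_) (sym eq) z<s)
      ... | b , (k , keq) , ⊑b , lt with ◁-parent {v} (subst (0 <_) (sym eq) z<s) | m≤n⇒m<n∨m≡n lt
      ...   | v◁ | inj₁ lt′ =
              b , (k , keq) , up v◁ ⊑b , subst (_< m + depth b) (sym (proj₂ v◁)) lt′
      -- The parent is on the last level of its block, so `v` is a cut node itself.
      ...   | v◁ | inj₂ eq′ =
              v , (suc k , trans (proj₂ v◁) (trans eq′ (cong (m +_) keq))) , here , m<n+m (depth v) 0<m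

    home-lowest : ∀ {v b b′} → Home v b → Cut b′ → v ⊑ b′ → depth b′ ≤ depth b
    home-lowest (cut , v⊑b , lt) cut′ v⊑b′ = cut-≤ cut′ cut (≤-<-trans (⊑-depth v⊑b′) lt)

    home-unique : ∀ {v b b′} → Home v b → Home v b′ → b ≡ b′
    home-unique h@(cut , v⊑b , _) h′@(cut′ , v⊑b′ , _) =
      ⊑-unique v⊑b v⊑b′ (≤-antisym (home-lowest h′ cut v⊑b) (home-lowest h cut′ v⊑b′))

-- The pieces are the fibres of `node`. All edges from the piece of `w` up to its parent's piece end
-- within `gap` of one point of the latter, the gate of `w`.
record TreeOfSpaces (H : Graph) : Set₁ where
  field
    tree : RootedTree
  open RootedTree tree public
  field
    node       : V H → Node
    node-step  : ∀ {p q} → E H p q →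
                 node p ≡ node q ⊎ node p ◁ node q ⊎ node q ◁ node p
    gate       : Node → V H
    node-gate  : ∀ w → node (gate w) ≡ parent w
    gap        : ℕ
    gate-near  : ∀ {p q} → E H p q → node p ◁ node q → Near H gap q (gate (node p))

-- Colouring trees of spaces

module _ (em : ExcludedMiddle 0ℓ) {H : Graph} (𝒯 : TreeOfSpaces H) where
  open TreeOfSpaces 𝒯

  depth-lipschitz : ∀ {r p q} → Near H r p q → depth (node p) ≤ r + depth (node q)
  depth-lipschitz (n , n≤r , w) = ≤-trans (go w) (+-monoˡ-≤ _ n≤r)
    where
    step : ∀ {p q} → E H p q → depth (node p) ≤ suc (depth (node q))
    step e with node-step e
    ... | inj₁ eq = ≤-trans (≤-reflexive (cong depth eq)) (n≤1+n _)
    ... | inj₂ (inj₁ (_ , eq)) = ≤-reflexive eq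
    ... | inj₂ (inj₂ (_ , eq)) = ≤-trans (n≤1+n _) (≤-trans (≤-reflexive (sym eq)) (n≤1+n _))
    go : ∀ {n p q} → Walk H n p q → depth (node p) ≤ n + depth (node q)
    go [] = ≤-refl
    go (e ∷ w) = ≤-trans (step e) (s≤s (go w))

  -- The walk leaves the subtree below `w` along an edge from the piece of `w` to that of its
  -- parent, and the upper end of this edge is within `gap` of the gate.
  near-gate : ∀ {r p q w} → Near H r p q → node p ⊑ w → ¬ node q ⊑ w →
              Near H (r + gap) p (gate w) × Near H (r + gap) q (gate w)
  near-gate {r} {w = w} (n , n≤r , walk) p⊑w q⋢w =
    let l , r = go walk p⊑w q⋢w in
    near-mono (+-monoˡ-≤ gap n≤r) l , near-mono (+-monoˡ-≤ gap n≤r) r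
    where
    go : ∀ {n p q} → Walk H n p q → node p ⊑ w → ¬ node q ⊑ w →
         Near H (n + gap) p (gate w) × Near H (n + gap) q (gate w)
    go [] p⊑w q⋢w = ⊥-elim (q⋢w p⊑w)
    go {suc n} (_∷_ {y = p₁} e walk) p⊑w q⋢w with em {P = node p₁ ⊑ w}
    ... | yes p₁⊑w =
          let l , r = go walk p₁⊑w q⋢w in
          near-trans (near-edge e) l , near-mono (n≤1+n _) r
    ... | no p₁⋢w with node-step e
    ...   | inj₁ eq = ⊥-elim (p₁⋢w (subst (_⊑ w) eq p⊑w))
    ...   | inj₂ (inj₂ p₁◁p) = ⊥-elim (p₁⋢w (up p₁◁p p⊑w))
    ...   | inj₂ (inj₁ p◁p₁) with ⊑-parent p⊑w p◁p₁
    ...     | inj₂ p₁⊑w = ⊥-elim (p₁⋢w p₁⊑w)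
    ...     | inj₁ refl =
              near-mono (s≤s (m≤n+m gap n)) (near-trans (near-edge e) (gate-near e p◁p₁)) ,
              near-mono (n≤1+n _)
                (near-trans (near-sym (n , ≤-refl , walk)) (gate-near e p◁p₁))

  module _ (C : Set) where

    InBlock : ℕ → Node → V H → Set
    InBlock j w p = node p ⊑ w × depth (node p) < j + depth w

    PiecesColourable : Set
    PiecesColourable = ∀ r → ∃[ R ] Σ[ c ∈ (V H → C) ]
      (∀ w i → Bounded H R r (λ p → node p ≡ w × c p ≡ i))

    -- Blocks of different `w` may overlap, so each has its own colouring; only the bound is common.
    BlocksColourable : ℕ → Set
    BlocksColourable j = ∀ r → ∃[ R ] (∀ w → Σ[ c ∈ (V H → C) ]
      (∀ i → Bounded H R r (λ p → InBlock j w p × c p ≡ i)))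

  -- Shallow points, those within r + gap of the gate of their child subtree, take the
  -- colour of the gate.  As a jump of length r between different subtrees only meets
  -- shallow points, a chain consists of points with a shadow (itself or the gate) in
  -- the piece of w and of excursions that are chains of a single child block.
  module BlockStep {C : Set} (j r B L : ℕ)
                   (block : ∀ w → Σ[ c ∈ (V H → C) ]
                      (∀ i → Bounded H B r (λ p → InBlock C j w p × c p ≡ i)))
                   (piece : V H → C) (w : Node) where
    private
      -- `s` is the distance from `near-gate` for a jump of length `r`. `e` bounds an excursion: `B`
      -- inside a child block, a jump of length `r`, and `s` to a shadow.
      s = r + gap
      e = B + (r + s)

    data View (p : V H) : Set where
      top     : node p ≡ w → View p
      shallow : ∀ {v} → v ◁ w → node p ⊑ v → Near H s p (gate v) → View p
      deep    : ∀ {v} → v ◁ w → node p ⊑ v → ¬ Near H s p (gate v) → View p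
      outside : ¬ node p ⊑ w → View p

    view : ∀ p → View p
    view p with em {P = node p ⊑ w}
    ... | no p⋢w = outside p⋢w
    ... | yes p⊑w with ⊑-child p⊑w
    ...   | inj₁ eq = top eq
    ...   | inj₂ (v , v◁w , p⊑v) with em {P = Near H s p (gate v)}
    ...     | yes near = shallow v◁w p⊑v near
    ...     | no far = deep v◁w p⊑v far

    paint : ∀ {p} → View p → C
    paint {p} (top _) = piece p
    paint (shallow {v} _ _ _) = piece (gate v)
    paint {p} (deep {v} _ _ _) = proj₁ (block v) p
    -- A default value, as such points are in no chain of the block.
    paint {p} (outside _) = piece p

    colour : V H → C
    colour p = paint (view p)

    module _ (i : C) where

      Q Top : V H → Set
      Q p = InBlock C (suc j) w p × colour p ≡ i
      Top z = node z ≡ w × piece z ≡ i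

      Inside : Node → V H → Set
      Inside v p = InBlock C j v p × proj₁ (block v) p ≡ i

      Deep : Node → V H → Set
      Deep v p = v ◁ w × Inside v p × ¬ Near H s p (gate v)

      classify : ∀ {p} → Q p → (∃[ z ] (Top z × Near H s p z)) ⊎ ∃[ v ] Deep v p
      classify {p} ((p⊑w , lt) , eq) with view p
      ... | top p≡w = inj₁ (p , (p≡w , eq) , near-refl)
      ... | shallow {v} v◁w _ near = inj₁ (gate v , (trans (node-gate v) (proj₁ v◁w) , eq) , near)
      ... | deep {v} v◁w p⊑v far = inj₂ (v , v◁w , ((p⊑v ,
              subst (depth (node p) <_) (trans (sym (+-suc j _)) (cong (j +_) (sym (proj₂ v◁w)))) lt) , eq) , far)
      ... | outside p⋢w = ⊥-elim (p⋢w p⊑w)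

      First : V H → V H → Set
      First x z = Near H s x z ⊎
        ∃[ v ] ∃[ x′ ] (Deep v x × Star (Link H r (Inside v)) x x′ × Near H (r + s) x′ z)

      first-near : ∀ {x z} → First x z → Near H e x z
      first-near (inj₁ near) = near-mono (≤-trans (m≤n+m s r) (m≤n+m (r + s) B)) near
      first-near (inj₂ (v , x′ , _ , chain , near)) = near-trans (proj₂ (block v) i chain) near

      Out : V H → V H → Set
      Out x y = (∃[ v ] (Deep v x × Star (Link H r (Inside v)) x y)) ⊎
        ∃[ z ] ∃[ z′ ] (First x z × Top z × Star (Link H L Top) z z′ × Near H e z′ y)

      -- By `near-gate`, a jump out of the subtree below `v` would bring `x` within `s` of the gate.
      same-child : ∀ {v v₁ x x₁} → Deep v x → Deep v₁ x₁ → Near H r x x₁ → v ≡ v₁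
      same-child {v} {x₁ = x₁} (v◁w , ((x⊑v , _) , _) , far) (v₁◁w , ((x₁⊑v₁ , _) , _) , _) near
        with em {P = node x₁ ⊑ v}
      ... | yes x₁⊑v = ⊑-unique x₁⊑v x₁⊑v₁ (trans (proj₂ v◁w) (sym (proj₂ v₁◁w)))
      ... | no x₁⋢v = ⊥-elim (far (proj₁ (near-gate near x⊑v x₁⋢v)))

      -- Built up from the end of the chain: a deep point prolongs the current excursion, which
      -- `same-child` keeps in one child block, and a point with a shadow closes it. Consecutive
      -- shadows are then within `s + (r + e)`.
      outcome : s + (r + e) ≤ L → ∀ {x y} → Star (Link H r Q) x y → Q y → Out x y
      outcome _ ε qy with classify qy
      ... | inj₁ (z , topz , near) = inj₂ (z , z , inj₁ near , topz , ε , near-sym (first-near (inj₁ near)))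
      ... | inj₂ (v , deepy) = inj₁ (v , deepy , ε)
      outcome L-large ((qx , _ , d) ◅ ls) qy with classify qx | outcome L-large ls qy
      ... | inj₁ (z , topz , near) | inj₁ (v , _ , chain) =
            inj₂ (z , z , inj₁ near , topz , ε ,
              near-sym (near-trans (near-sym (proj₂ (block v) i chain)) (near-trans (near-sym d) near)))
      ... | inj₁ (z , topz , near) | inj₂ (z₁ , z′ , first , topz₁ , chain , last) =
            inj₂ (z , z′ , inj₁ near , topz ,
              (topz , topz₁ , near-mono L-large
                (near-trans (near-sym near) (near-trans d (first-near first)))) ◅ chain , last)
      ... | inj₂ (v , deepx) | inj₁ (v₁ , deepx₁ , chain) with same-child deepx deepx₁ d
      ...   | refl = inj₁ (v , deepx , (proj₁ (proj₂ deepx) , proj₁ (proj₂ deepx₁) , d) ◅ chain)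
      outcome L-large ((qx , _ , d) ◅ ls) qy | inj₂ (v , deepx) | inj₂ (z₁ , z′ , inj₁ near , rest) =
            inj₂ (z₁ , z′ , inj₂ (v , _ , deepx , ε , near-trans d near) , rest)
      outcome L-large ((qx , _ , d) ◅ ls) qy
          | inj₂ (v , deepx) | inj₂ (z₁ , z′ , inj₂ (v₁ , x′ , deepx₁ , chain , near) , rest)
          with same-child deepx deepx₁ d
      ... | refl = inj₂ (z₁ , z′ , inj₂ (v , x′ , deepx ,
                     (proj₁ (proj₂ deepx) , proj₁ (proj₂ deepx₁) , d) ◅ chain , near) , rest)

      block-bounded : ∀ {R} → s + (r + e) ≤ L → Bounded H R L Top → Bounded H (e + (R + e)) r Q
      block-bounded _ _ ε = near-refl
      block-bounded {R} L-large bounded ls@((qx , _) ◅ _) with outcome L-large ls (chain-end {P = Q} qx ls)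
      ... | inj₁ (v , _ , chain) =
            near-mono (≤-trans (m≤m+n B (r + s)) (m≤m+n e (R + e))) (proj₂ (block v) i chain)
      ... | inj₂ (z , z′ , first , _ , chain , last) =
            near-trans (first-near first) (near-trans (bounded chain) last)

  blocks-colourable : ∀ {C} → PiecesColourable C → ∀ j → BlocksColourable C j
  blocks-colourable pieces zero r =
    0 , λ w → proj₁ (proj₂ (pieces r)) , λ where
      i ε → near-refl
      i ((((p⊑w , lt) , _) , _) ◅ _) → ⊥-elim (<⇒≱ lt (⊑-depth p⊑w))
  blocks-colourable pieces (suc j) r with blocks-colourable pieces j r
  -- The pieces are coloured last, at the scale `s + (r + e)` that links consecutive shadows and
  -- depends on `B`.
  ... | B , block with pieces (r + gap + (r + (B + (r + (r + gap)))))
  ...   | R , c , bounded = _ , λ w →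
          BlockStep.colour j r B _ block c w ,
          λ i → BlockStep.block-bounded j r B _ block c w i ≤-refl (bounded w i)

  -- Cut the tree at the depths divisible by m.  Below a cut node b the points within
  -- s of its gate take the colour of the gate, and those at distance between s and
  -- 2s take another colour; hence no monochromatic r-chain enters or leaves the set
  -- In b of the points below b at distance more than s from the gate.  A chain
  -- therefore stays, up to distance s, in one block.
  module CutStep {C : Set} (other : C → C) (other-≢ : ∀ p → other p ≢ p) (r : ℕ) where
    private
      s m L : ℕ
      -- `m` exceeds `s + s`, so both layers below a cut node stay in the block of that node. `L`
      -- links shadows, each within `s` of its point, of two points at distance `r`.
      s = r + gap
      m = suc (s + s)
      L = s + (r + s)

    open Levels m z<s

    homeOf : Node → Node
    homeOf v = proj₁ (home v)

    module _ {B : ℕ} (block : ∀ w → Σ[ c ∈ (V H → C) ]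
                      (∀ i → Bounded H B L (λ p → InBlock C m w p × c p ≡ i))) where

      hue : Node → V H → C
      hue b = proj₁ (block b)

      -- The colour of the gate in its own block, before any layers are painted there.
      gateHue : Node → C
      gateHue b = hue (homeOf (parent b)) (gate b)

      paint : Node → V H → C
      paint b p with depth b ≟ 0 | em {P = Near H s p (gate b)} | em {P = Near H (s + s) p (gate b)}
      -- The block of the root has nothing above it and gets no layers.
      ... | yes _ | _     | _     = hue b p
      ... | no _  | yes _ | _     = gateHue b
      ... | no _  | no _  | yes _ = other (gateHue b)
      ... | no _  | no _  | no _  = hue b p

      paint-inner : ∀ {b p} → depth b ≢ 0 → Near H s p (gate b) → paint b p ≡ gateHue b
      paint-inner {b} {p} d≢0 near with depth b ≟ 0 | em {P = Near H s p (gate b)} | em {P = Near H (s + s) p (gate b)}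
      ... | yes d≡0 | _     | _     = ⊥-elim (d≢0 d≡0)
      ... | no _  | yes _ | _     = refl
      ... | no _  | no far  | _ = ⊥-elim (far near)

      paint-outer : ∀ {b p} → depth b ≢ 0 → ¬ Near H s p (gate b) → Near H (s + s) p (gate b) →
                    paint b p ≡ other (gateHue b)
      paint-outer {b} {p} d≢0 far near with depth b ≟ 0 | em {P = Near H s p (gate b)} | em {P = Near H (s + s) p (gate b)}
      ... | yes d≡0 | _     | _     = ⊥-elim (d≢0 d≡0)
      ... | no _  | yes near′ | _     = ⊥-elim (far near′)
      ... | no _  | no _  | yes _ = refl
      ... | no _  | no _  | no far′ = ⊥-elim (far′ near)

      paint-core : ∀ b p → paint b p ≡ hue b p ⊎ Near H (s + s) p (gate b)
      paint-core b p with depth b ≟ 0 | em {P = Near H s p (gate b)} | em {P = Near H (s + s) p (gate b)}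
      ... | yes _ | _     | _     = inj₁ refl
      ... | no _  | yes near | _     = inj₂ (near-mono (m≤m+n s s) near)
      ... | no _  | no _  | yes near = inj₂ near
      ... | no _  | no _  | no _  = inj₁ refl

      colour : V H → C
      colour p = paint (homeOf (node p)) p

      near-home : ∀ {b p} → Cut b → depth b ≢ 0 → node p ⊑ b → Near H (s + s) p (gate b) →
                  homeOf (node p) ≡ b
      near-home {b} {p} cut d≢0 p⊑b near =
        home-unique (proj₂ (home (node p))) (cut , p⊑b , s≤s (begin
          depth (node p)                  ≤⟨ depth-lipschitz near ⟩
          s + s + depth (node (gate b))   ≡⟨ cong (λ v → s + s + depth v) (node-gate b) ⟩
          s + s + depth (parent b)        ≤⟨ +-monoʳ-≤ (s + s) (n≤1+n _) ⟩
          s + s + suc (depth (parent b))  ≡⟨ cong (s + s +_) (depth-parent b (n≢0⇒n>0 d≢0)) ⟨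
          s + s + depth b                 ∎))
        where open ≤-Reasoning

      In : Node → V H → Set
      In b p = node p ⊑ b × (depth b ≡ 0 ⊎ ¬ Near H s p (gate b))

      -- A jump out of the subtree would start within `s` of the gate. A jump into the inner layer
      -- would start in the outer one, whose colour is different.
      in-step : ∀ {b x y} → Cut b → colour x ≡ colour y → Near H r x y → In b x → In b y
      in-step {b} {x} {y} cut same d (x⊑b , inj₁ d≡0) =
        subst (node y ⊑_) (sym (depth-root b d≡0)) (⊑-root (node y)) , inj₁ d≡0
      in-step {b} {x} {y} cut same d (x⊑b , inj₂ far)
        with depth b ≟ 0 | em {P = node y ⊑ b} | em {P = Near H s y (gate b)}
      ... | yes d≡0 | _ | _ = in-step cut same d (x⊑b , inj₁ d≡0)
      ... | no _ | no y⋢b | _ = ⊥-elim (far (proj₁ (near-gate d x⊑b y⋢b)))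
      ... | no _ | yes y⊑b | no far′ = y⊑b , inj₂ far′
      ... | no d≢0 | yes y⊑b | yes near =
            ⊥-elim (other-≢ (gateHue b) (trans (sym x-colour) (trans same y-colour)))
        where
        x-near : Near H (s + s) x (gate b)
        x-near = near-mono (+-monoˡ-≤ s (m≤m+n r gap)) (near-trans d near)
        x-colour : colour x ≡ other (gateHue b)
        x-colour = trans (cong (λ h → paint h x) (near-home cut d≢0 x⊑b x-near)) (paint-outer d≢0 far x-near)
        y-colour : colour y ≡ gateHue b
        y-colour = trans (cong (λ h → paint h y)
                       (near-home cut d≢0 y⊑b (near-mono (m≤m+n s s) near))) (paint-inner d≢0 near)

      -- By `in-step` the cut nodes `b` with `In b` do not change along a monochromatic `r`-chain,
      -- so the deepest of them is an invariant of the chain.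
      Lowest : Node → V H → Set
      Lowest κ x = Cut κ × In κ x × (∀ b → Cut b → In b x → depth b ≤ depth κ)

      Shape : Node → V H → Set
      Shape κ x = homeOf (node x) ≡ κ ⊎
        ∃[ b ] (Cut b × depth b ≢ 0 × node x ⊑ b × Near H s x (gate b) × homeOf (parent b) ≡ κ)

      lowest-unique : ∀ {κ κ′ x} → Lowest κ x → Lowest κ′ x → κ ≡ κ′
      lowest-unique (cut , in-κ , maximal) (cut′ , in-κ′ , maximal′) =
        ⊑-unique (proj₁ in-κ) (proj₁ in-κ′) (≤-antisym (maximal′ _ cut in-κ) (maximal _ cut′ in-κ′))

      lowest-step : ∀ {κ x y} → colour x ≡ colour y → Near H r x y → Lowest κ x → Lowest κ y
      lowest-step same d (cut , in-κ , maximal) =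
        cut , in-step cut same d in-κ ,
        λ b cut-b in-b → maximal b cut-b (in-step cut-b (sym same) (near-sym d) in-b)

      -- If `x` is in the inner layer of its block, pass to the block above. There it is not in the
      -- inner layer again, since by `near-home` that block would then be its home.
      lowest : ∀ x → ∃[ κ ] (Lowest κ x × Shape κ x)
      lowest x = from (proj₂ (home (node x))) refl
        where
        from : ∀ {b} → Home (node x) b → homeOf (node x) ≡ b → ∃[ κ ] (Lowest κ x × Shape κ x)
        from {b} h@(cut , x⊑b , _) eq with depth b ≟ 0 | em {P = Near H s x (gate b)}
        ... | yes d≡0 | _ = b , (cut , (x⊑b , inj₁ d≡0) , λ b′ cut′ in′ → home-lowest h cut′ (proj₁ in′)) , inj₁ eq
        ... | no _ | no far = b , (cut , (x⊑b , inj₂ far) , λ b′ cut′ in′ → home-lowest h cut′ (proj₁ in′)) , inj₁ eq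
        ... | no d≢0 | yes near = κ , (cut-κ , in-κ , maximal) , inj₂ (b , cut , d≢0 , x⊑b , near , refl)
          where
          κ = homeOf (parent b)
          h-κ = proj₂ (home (parent b))
          cut-κ = proj₁ h-κ
          b◁ = ◁-parent {b} (n≢0⇒n>0 d≢0)
          x⊑parent = ⊑-trans x⊑b (up b◁ here)
          x⊑κ = ⊑-trans x⊑parent (proj₁ (proj₂ h-κ))
          κ<b : depth κ < depth b
          κ<b = ≤-trans (s≤s (⊑-depth (proj₁ (proj₂ h-κ)))) (≤-reflexive (sym (proj₂ b◁)))
          in-κ : In κ x
          in-κ with depth κ ≟ 0 | em {P = Near H s x (gate κ)}
          ... | yes d≡0 | _ = x⊑κ , inj₁ d≡0
          ... | no _ | no far = x⊑κ , inj₂ far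
          ... | no κ≢0 | yes near-κ = ⊥-elim (<-irrefl
                (cong depth (trans (sym (near-home cut-κ κ≢0 x⊑κ (near-mono (m≤m+n s s) near-κ))) eq)) κ<b)
          maximal : ∀ b′ → Cut b′ → In b′ x → depth b′ ≤ depth κ
          maximal b′ cut′ (x⊑b′ , in′) with m≤n⇒m<n∨m≡n (home-lowest h cut′ x⊑b′)
          ... | inj₁ lt = home-lowest h-κ cut′
                (⊑-linear x⊑parent x⊑b′ (≤-pred (≤-trans lt (≤-reflexive (proj₂ b◁)))))
          ... | inj₂ deq with ⊑-unique x⊑b′ x⊑b deq
          ...   | refl with in′
          ...     | inj₁ d≡0 = ⊥-elim (d≢0 d≡0)
          ...     | inj₂ far = ⊥-elim (far near)

      module _ (i : C) (κ : Node) where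

        Top : V H → Set
        Top t = InBlock C m κ t × hue κ t ≡ i

        classify : ∀ {z} → Lowest κ z → colour z ≡ i →
                   Near H (s + s) z (gate κ) ⊎ ∃[ t ] (Top t × Near H s z t)
        classify {z} low cz with lowest z
        ... | κ′ , low′ , shape with lowest-unique low′ low
        classify {z} low cz | κ′ , low′ , inj₁ refl | refl with paint-core κ z
        ... | inj₂ near = inj₁ near
        ... | inj₁ eq = inj₂ (z , (proj₂ (proj₂ (home (node z))) , trans (sym eq) cz) , near-refl)
        classify {z} low cz | κ′ , low′ , inj₂ (b , cut , d≢0 , z⊑b , near , refl) | refl =
          inj₂ (gate b , (subst (λ v → v ⊑ κ × depth v < m + depth κ) (sym (node-gate b))
                            (proj₂ (proj₂ (home (parent b)))) ,
                trans (sym (trans (cong (λ h → paint h z)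
                    (near-home cut d≢0 z⊑b (near-mono (m≤m+n s s) near))) (paint-inner d≢0 near))) cz) , near)

        Reach : V H → V H → Set
        Reach x t = Near H (s + s) x t ⊎
          ∃[ a ] ∃[ a′ ] (Near H s x a × Top a × Star (Link H L Top) a a′ × Near H (s + (r + (s + s))) a′ t)

        reach-near : ∀ {x t} → Reach x t → Near H (s + (B + (s + (r + (s + s))))) x t
        reach-near (inj₁ near) = near-mono
          (≤-trans (≤-trans (m≤n+m (s + s) r) (m≤n+m _ s)) (≤-trans (m≤n+m _ B) (m≤n+m _ s))) near
        reach-near (inj₂ (a , a′ , near , _ , chain , near′)) =
          near-trans near (near-trans (proj₂ (block κ) i chain) near′)

        extend : ∀ {x x₁ a t} → Near H r x x₁ → Top a → Near H s x a → Reach x₁ t → Reach x t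
        extend d top near (inj₁ near′) =
          inj₂ (_ , _ , near , top , ε , near-trans (near-sym near) (near-trans d near′))
        extend d top near (inj₂ (a₁ , a′ , near₁ , top₁ , chain , near′)) =
          inj₂ (_ , a′ , near , top ,
            (top , top₁ , near-trans (near-sym near) (near-trans d near₁)) ◅ chain , near′)

        -- Follow the shadows in the block of `κ` up to the end of the chain, or stop at the first
        -- point within `s + s` of the gate of `κ`.
        reach : ∀ {x y} → Lowest κ x → Star (Link H r (λ p → colour p ≡ i)) x y →
                Reach x y ⊎ Reach x (gate κ)
        reach low ε = inj₁ (inj₁ near-refl)
        reach low ((cx , cx₁ , d) ◅ ls)
          with classify low cx | reach (lowest-step (trans cx (sym cx₁)) d low) ls
        ... | inj₁ near | _ = inj₂ (inj₁ near)
        ... | inj₂ (a , top , near) | inj₁ rch = inj₁ (extend d top near rch)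
        ... | inj₂ (a , top , near) | inj₂ rch = inj₂ (extend d top near rch)

      lowest-chain : ∀ {i κ x y} → Star (Link H r (λ p → colour p ≡ i)) x y → Lowest κ x → Lowest κ y
      lowest-chain ε low = low
      lowest-chain ((cx , cx₁ , d) ◅ ls) low = lowest-chain ls (lowest-step (trans cx (sym cx₁)) d low)

      -- Apply `reach` from both ends: one run arrives at the other end, or both ends are close to
      -- the gate of the same `κ`.
      colour-bounded : ∀ i → let E = s + (B + (s + (r + (s + s)))) in
                       Bounded H (E + E) r (λ p → colour p ≡ i)
      colour-bounded i {x} {y} chain with lowest x
      ... | κ , low , _ with reach i κ low chain
                           | reach i κ (lowest-chain chain low) (chain-sym {P = λ p → colour p ≡ i} chain)
      ...   | inj₁ xy | _ = near-mono (m≤m+n _ _) (reach-near i κ xy)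
      ...   | inj₂ _ | inj₁ yx = near-mono (m≤m+n _ _) (near-sym (reach-near i κ yx))
      ...   | inj₂ xg | inj₂ yg = near-trans (reach-near i κ xg) (near-sym (reach-near i κ yg))

  other : ∀ {n} → Fin (suc (suc n)) → Fin (suc (suc n))
  other zero = suc zero
  other (suc _) = zero

  tree-colourable : ∀ {n} → PiecesColourable (Fin (suc (suc n))) → Colourable H (suc n)
  tree-colourable {n} pieces r =
    let B , block = blocks-colourable pieces _ _ in
    _ , CutStep.colour other other-≢ r block , CutStep.colour-bounded other other-≢ r block
    where
    other-≢ : ∀ (p : Fin (suc (suc n))) → other p ≢ p
    other-≢ zero ()
    other-≢ (suc _) ()

-- Bipartite trees

module _ {G : Graph} where

  -- Past its length the walk rests at its last vertex, so positions need no bound.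
  at : ∀ {n x y} → Walk G n x y → ℕ → V G
  at {x = x} [] _ = x
  at {x = x} (_ ∷ _) zero = x
  at (_ ∷ w) (suc i) = at w i

  at-0 : ∀ {n x y} (w : Walk G n x y) → at w 0 ≡ x
  at-0 [] = refl
  at-0 (_ ∷ _) = refl

  at-end : ∀ {n x y} (w : Walk G n x y) → at w n ≡ y
  at-end [] = refl
  at-end (_ ∷ w) = at-end w

  at-edge : ∀ {n x y} (w : Walk G n x y) i → i < n → E G (at w i) (at w (suc i))
  at-edge (e ∷ w) zero _ = subst (E G _) (sym (at-0 w)) e
  at-edge (e ∷ w) (suc i) (s≤s i<n) = at-edge w i i<n

  at-preserves : ∀ {P : Pred (V G) 0ℓ} → (∀ {x y} → E G x y → P x → P y) →
                 ∀ {n x y} (w : Walk G n x y) → P x → ∀ i → P (at w i)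
  at-preserves step [] px _ = px
  at-preserves step (e ∷ w) px zero = px
  at-preserves step (e ∷ w) px (suc i) = at-preserves step w (step e px) i

  shortcut : ∀ {n x y} (w : Walk G n x y) i → suc i < n → at w i ≡ at w (2 + i) →
             ∃[ m ] (m < n × Walk G m x y)
  shortcut (e ∷ e′ ∷ w) zero _ eq = _ , n≤1+n _ , subst (λ x → Walk G _ x _) (sym (trans eq (at-0 w))) w
  shortcut (e ∷ w) (suc i) (s≤s i<n) eq with shortcut w i i<n eq
  ... | m , m<n , w′ = suc m , s≤s m<n , e ∷ w′

module _ {T : Graph} (acyclic : ¬ Cycle T) where

  NonBacktracking : (ℕ → V T) → ℕ → Set
  NonBacktracking f ℓ = (∀ i → i < ℓ → E T (f i) (f (suc i))) × (∀ i → suc i < ℓ → f i ≢ f (2 + i))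

  private
    window : ∀ {f ℓ i j} → NonBacktracking f ℓ → i < j → j ≤ ℓ → NonBacktracking (λ k → f (k + i)) (j ∸ i)
    window {i = i} {j} (edges , turns) i<j j≤ℓ =
      (λ k k< → edges (k + i) (shift k<)) , (λ k k< → turns (k + i) (shift k<))
      where
      shift : ∀ {k} → k < j ∸ i → k + i < _
      shift k< = ≤-trans (subst (_ <_) (m∸n+n≡m (<⇒≤ i<j)) (+-monoˡ-< i k<)) j≤ℓ

    -- Strong induction with `n` as bound on the length. Shorter windows do not close up, so a
    -- closed walk of length at least 3 has distinct vertices and is a cycle.
    open-walk : ∀ n {f ℓ} → ℓ ≤ n → NonBacktracking f ℓ → 0 < ℓ → f 0 ≢ f ℓ
    open-walk n {f} {1} _ (edges , _) _ eq = E-irr T (subst (λ x → E T x (f 1)) eq (edges 0 z<s))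
    open-walk n {f} {2} _ (_ , turns) _ eq = turns 0 ≤-refl eq
    open-walk (suc n) {f} {suc (suc (suc e))} (s≤s ℓ≤n) nb@(edges , _) _ eq = acyclic record
      { excess = e
      ; vertex = f ∘ toℕ
      ; inj = injective _ _
      ; step = λ i → subst (λ k → E T (f k) (f (suc (toℕ i)))) (sym (Finₚ.toℕ-inject₁ i))
                       (edges (toℕ i) (≤-trans (Finₚ.toℕ<n i) (n≤1+n _)))
      ; close = subst (λ k → E T (f k) (f 0)) (sym (Finₚ.toℕ-fromℕ (2 + e)))
                  (subst (E T (f (2 + e))) (sym eq) (edges (2 + e) ≤-refl))
      }
      where
      distinct : ∀ i j → i < j → j < 3 + e → f i ≢ f j
      distinct i j i<j j<ℓ fi≡fj =
        open-walk n (≤-trans (m∸n≤m j i) (≤-trans (≤-pred j<ℓ) ℓ≤n)) (window nb i<j (<⇒≤ j<ℓ))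
          (m<n⇒0<n∸m i<j) (trans fi≡fj (cong f (sym (m∸n+n≡m (<⇒≤ i<j)))))

      injective : ∀ i j → f (toℕ {3 + e} i) ≡ f (toℕ {3 + e} j) → i ≡ j
      injective i j fi≡fj with <-cmp (toℕ i) (toℕ j)
      ... | tri< i<j _ _ = ⊥-elim (distinct _ _ i<j (Finₚ.toℕ<n j) fi≡fj)
      ... | tri≈ _ i≡j _ = Finₚ.toℕ-injective i≡j
      ... | tri> _ _ j<i = ⊥-elim (distinct _ _ j<i (Finₚ.toℕ<n i) (sym fi≡fj))

  nonBacktracking-distinct : ∀ {f ℓ i j} → NonBacktracking f ℓ → i < j → j ≤ ℓ → f i ≢ f j
  nonBacktracking-distinct {f} {i = i} nb i<j j≤ℓ eq =
    open-walk _ ≤-refl (window nb i<j j≤ℓ) (m<n⇒0<n∸m i<j)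
      (trans eq (cong f (sym (m∸n+n≡m (<⇒≤ i<j)))))

  -- A walk without backtracking, indexed by its first two and last two vertices so that it can be
  -- extended at either end.
  data Reduced : ℕ → V T → V T → V T → V T → Set where
    edge : ∀ {x y} → E T x y → Reduced 1 x y x y
    cons : ∀ {n x y z a b} → E T x y → x ≢ z → Reduced n y z a b → Reduced (suc n) x y a b

  snoc : ∀ {n x y a b c} → Reduced n x y a b → E T b c → a ≢ c → Reduced (suc n) x y b c
  snoc (edge e) e′ a≢c = cons e a≢c (edge e′)
  snoc (cons e x≢z w) e′ a≢c = cons e x≢z (snoc w e′ a≢c)

  private
    walk : ∀ {n x y a b} → Reduced n x y a b → Walk T n x b
    walk (edge e) = e ∷ []
    walk (cons e _ w) = e ∷ walk w

    second : ∀ {n x y a b} (w : Reduced n x y a b) → at (walk w) 1 ≡ y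
    second (edge _) = refl
    second (cons _ _ w) = at-0 (walk w)

    turns : ∀ {n x y a b} (w : Reduced n x y a b) i → suc i < n → at (walk w) i ≢ at (walk w) (2 + i)
    turns (edge e) i (s≤s ())
    turns (cons _ x≢z w) zero _ eq = x≢z (trans eq (second w))
    turns (cons _ _ w) (suc i) (s≤s i<n) = turns w i i<n

    positive : ∀ {n x y a b} → Reduced n x y a b → 0 < n
    positive (edge _) = z<s
    positive (cons _ _ _) = z<s

  reduced-open : ∀ {n x y a b} → Reduced n x y a b → x ≢ b
  reduced-open w x≡b =
    nonBacktracking-distinct (at-edge (walk w) , turns w) (positive w) ≤-refl
      (trans (at-0 (walk w)) (trans x≡b (sym (at-end (walk w)))))

module BipartiteTree (em : ExcludedMiddle 0ℓ) (T : Graph) (isTree : IsTree T)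
                     (side : V T → Side) (bipartite : ∀ {u v} → E T u v → Opposite (side u) (side v)) where
  private
    conn = proj₁ isTree
    acyclic = proj₂ isTree
    root = proj₁ conn

  depth : V T → ℕ
  depth v = dist em T conn v root

  shallow⇒root : ∀ v → depth v ≡ 0 → v ≡ root
  shallow⇒root v eq with dist⇒near em T conn (≤-reflexive eq)
  ... | zero , _ , [] = refl

  depth-edge : ∀ {u v} → E T u v → depth u ≤ suc (depth v)
  depth-edge e = proj₂ (geodesic em T conn _ root) _ (e ∷ proj₁ (geodesic em T conn _ root))

  Lower : V T → V T → Set
  Lower v p = E T v p × depth v ≡ suc (depth p)

  lower : ∀ v → 0 < depth v → ∃ (Lower v)
  lower v = go (proj₁ (geodesic em T conn v root)) refl
    where
    go : ∀ {n} → Walk T n v root → n ≡ depth v → 0 < n → ∃ (Lower v)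
    go (_∷_ {y = p} e w) eq _ = p , e , ≤-antisym (depth-edge e)
      (subst (suc (depth p) ≤_) eq (s≤s (proj₂ (geodesic em T conn p root) _ w)))

  -- If `p` and `q` differ, extend the walk p, v, q at both ends towards the root. Depths drop at
  -- each step, so it never backtracks, yet it closes up at the root.
  lower-unique : ∀ {v p q} → Lower v p → Lower v q → p ≡ q
  lower-unique {v} {p} {q} (vp , dp) (vq , dq) = decidable-stable em λ p≢q →
    grow (depth p) refl (suc-injective (trans (sym dq) dp)) dp dp
      (cons (E-sym T vp) p≢q (edge vq))
    where
    above : ∀ {a b} → depth a ≡ suc (suc (depth b)) → a ≢ b
    above eq refl = m≢1+n+m _ eq
    grow : ∀ k {n p a b q} → depth p ≡ k → depth q ≡ k → depth a ≡ suc k → depth b ≡ suc k →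
           Reduced acyclic n p a b q → ⊥
    grow zero dp dq _ _ w = reduced-open acyclic w (trans (shallow⇒root _ dp) (sym (shallow⇒root _ dq)))
    grow (suc k) {p = p} {q = q} dp dq da db w
      with lower p (subst (0 <_) (sym dp) z<s) | lower q (subst (0 <_) (sym dq) z<s)
    ... | p′ , pp′ , dp′ | q′ , qq′ , dq′ =
      grow k p′≡k q′≡k dp dq
        (cons (E-sym T pp′) (λ eq → above (trans da (cong suc (trans (sym dp) dp′))) (sym eq))
          (snoc acyclic w qq′ (above (trans db (cong suc (trans (sym dq) dq′))))))
      where
      p′≡k = suc-injective (trans (sym dp′) dp)
      q′≡k = suc-injective (trans (sym dq′) dq)

  parentOf : ∀ v → Dec (0 < depth v) → V T
  parentOf v (yes 0<d) = proj₁ (lower v 0<d)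
  parentOf v (no _) = v

  rooted : RootedTree
  rooted = record
    { Node = V T ; root = root ; depth = depth
    ; parent = λ v → parentOf v (0 <? depth v)
    ; depth-parent = depth-parent
    ; depth-root = shallow⇒root }
    where
    depth-parent : ∀ v → 0 < depth v → depth v ≡ suc (depth (parentOf v (0 <? depth v)))
    depth-parent v 0<d with 0 <? depth v
    ... | yes 0<d′ = proj₂ (proj₂ (lower v 0<d′))
    ... | no ≮ = ⊥-elim (≮ 0<d)

  open RootedTree rooted using (_◁_)

  lower⇒◁ : ∀ {u v} → Lower u v → u ◁ v
  lower⇒◁ {u} low@(_ , eq) with 0 <? depth u
  ... | yes 0<d = lower-unique (proj₂ (lower u 0<d)) low , eq
  ... | no ≮ = ⊥-elim (≮ (subst (0 <_) (sym eq) z<s))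

  side-walk : ∀ {n x x′ y y′} → Walk T n x y → Walk T n x′ y′ → side x ≡ side x′ → side y ≡ side y′
  side-walk [] [] eq = eq
  side-walk (e ∷ w) (e′ ∷ w′) eq = side-walk w w′ (functional eq (bipartite e) (bipartite e′))
    where
    functional : ∀ {i i′ j j′} → i ≡ i′ → Opposite i j → Opposite i′ j′ → j ≡ j′
    functional refl ①② ①② = refl
    functional refl ②① ②① = refl

  -- Walks of equal length from the root end on the same side, so adjacent nodes have different
  -- depths.
  edge-◁ : ∀ {u v} → E T u v → u ◁ v ⊎ v ◁ u
  edge-◁ {u} {v} e with <-cmp (depth u) (depth v)
  ... | tri< u<v _ _ = inj₂ (lower⇒◁ (E-sym T e , ≤-antisym (depth-edge (E-sym T e)) u<v))
  ... | tri> _ _ v<u = inj₁ (lower⇒◁ (e , ≤-antisym (depth-edge e) v<u))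
  ... | tri≈ _ eq _ = ⊥-elim (irreflexive same-side (bipartite e))
    where
    irreflexive : ∀ {i j} → i ≡ j → ¬ Opposite i j
    irreflexive refl ()
    same-side : side u ≡ side v
    same-side = side-walk (reverseʷ (proj₁ (geodesic em T conn u root)))
      (subst (λ n → Walk T n root v) (sym eq) (reverseʷ (proj₁ (geodesic em T conn v root)))) refl

-- The graph G₁ + G₂ as a tree of spaces

module _ {G : Side → Graph} (A : TreeAmalgamation G) where
  open TreeAmalgamation A

  φ-inverse : ∀ {i j} (o : Opposite i j) (k : I i) (l : I j) x → φ (flipped o) l k (φ o k l x) ≡ x
  φ-inverse ①② k l x = Inverse.strictlyInverseʳ (bonding k l) x
  φ-inverse ②① k l x = Inverse.strictlyInverseˡ (bonding l k) x

  cross-sym : ∀ {p q} → Cross p q → Cross q p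
  cross-sym (cross {u} {v} e e′ o x) =
    subst (λ y → Cross (v , value z) (u , value y)) (φ-inverse o (label e) (label e′) x)
          (cross e′ e (flipped o) z)
    where z = φ o (label e) (label e′) x

  module _ (em : ExcludedMiddle 0ℓ) where

    adh-member : ∀ {i} {k : I i} (x : Adh k) → S k (value x)
    adh-member (x , [ p ]) = recompute em p

  -- Restricted to labels of edges of `T`: they come with an opposite label, through which
  -- consistency applies.
  AdhesionDiameter : ℕ → Set
  AdhesionDiameter D = ∀ {u v} (e : E T u v) {x y} → S (label e) x → S (label e) y →
                       Near (G (side u)) D x y

module PlusTree (em : ExcludedMiddle 0ℓ) {G : Side → Graph} (A : TreeAmalgamation G)
                (conn : ∀ i → Connected (G i)) {D : ℕ} (diam : AdhesionDiameter A D) where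
  open TreeAmalgamation A
  open BipartiteTree em T tree side bipartite using (rooted; edge-◁)
  open RootedTree rooted

  -- The default is harmless: without an adhesion point there is no cross edge between the two
  -- copies.
  base : ∀ w → V T → V (G (side w))
  base w a with em {P = Σ[ e ∈ E T w a ] ∃ (S (label e))}
  ... | yes (_ , x , _) = x
  ... | no _ = proj₁ (conn (side w))

  base-near : ∀ {w a x} (e : E T w a) → S (label e) x → Near (G (side w)) D x (base w a)
  base-near {w} {a} {x} e sx with em {P = Σ[ e ∈ E T w a ] ∃ (S (label e))}
  ... | yes (e′ , y , sy) = diam e sx (subst (λ k → S k y) (label-irr e′ e) sy)
  ... | no none = ⊥-elim (none (e , x , sx))

  near-copy : ∀ {v r x y} → Near (G (side v)) r x y → Near Plus r (v , x) (v , y)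
  near-copy {v} (n , n≤r , w) = n , n≤r , copy w
    where
    copy : ∀ {n x y} → Walk (G (side v)) n x y → Walk Plus n (v , x) (v , y)
    copy [] = []
    copy (e ∷ w) = inj₁ (inner e) ∷ copy w

  ◁-irrefl : ∀ {v} → ¬ v ◁ v
  ◁-irrefl {v} (_ , eq) = m≢1+n+m (depth v) {0} eq

  treeOfSpaces : TreeOfSpaces Plus
  treeOfSpaces = record
    { tree = rooted
    ; node = proj₁
    ; node-step = λ where
        (inj₁ (inner _)) → inj₁ refl
        (inj₂ (cross e _ _ _)) → inj₂ (edge-◁ e)
    ; gate = λ w → parent w , base (parent w) w
    ; node-gate = λ _ → refl
    ; gap = D
    ; gate-near = gate-near }
    where
    gate-near : ∀ {p q} → E Plus p q → proj₁ p ◁ proj₁ q →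
                Near Plus D q (parent (proj₁ p) , base (parent (proj₁ p)) (proj₁ p))
    gate-near (inj₁ (inner _)) loop = ⊥-elim (◁-irrefl loop)
    gate-near (inj₂ (cross e e′ o x)) (refl , _) =
      near-copy (base-near e′ (adh-member A em (φ o (label e) (label e′) x)))

  module _ (w : V T) where

    -- The neighbour a of w on the path from w to v.
    data Towards : V T → V T → Set where
      down : ∀ {v a} → a ◁ w → v ⊑ a → Towards v a
      away : ∀ {v} → ¬ v ⊑ w → Towards v (parent w)

    towards-unique : ∀ {v a b} → Towards v a → Towards v b → a ≡ b
    towards-unique (down a◁w v⊑a) (down b◁w v⊑b) =
      ⊑-unique v⊑a v⊑b (trans (proj₂ a◁w) (sym (proj₂ b◁w)))
    towards-unique (down a◁w v⊑a) (away v⋢w) = ⊥-elim (v⋢w (⊑-trans v⊑a (up a◁w here)))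
    towards-unique (away v⋢w) (down a◁w v⊑a) = ⊥-elim (v⋢w (⊑-trans v⊑a (up a◁w here)))
    towards-unique (away _) (away _) = refl

    towards : ∀ {v} → v ≢ w → ∃ (Towards v)
    towards {v} v≢w with em {P = v ⊑ w}
    ... | no v⋢w = parent w , away v⋢w
    ... | yes v⊑w with ⊑-child v⊑w
    ...   | inj₁ v≡w = ⊥-elim (v≢w v≡w)
    ...   | inj₂ (a , a◁w , v⊑a) = a , down a◁w v⊑a

    towards-neighbour : ∀ {v} → w ◁ v ⊎ v ◁ w → Towards v v
    towards-neighbour (inj₂ v◁w) = down v◁w here
    towards-neighbour {v} (inj₁ w◁v@(refl , eq)) =
      away λ v⊑w → <-irrefl refl (subst (_≤ depth v) eq (⊑-depth v⊑w))

    towards-parent : ∀ {u v a} → v ≢ w → u ◁ v → Towards u a → Towards v a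
    towards-parent v≢w u◁v (away u⋢w) = away (u⋢w ∘ up u◁v)
    towards-parent v≢w u◁v (down a◁w u⊑a) with ⊑-parent u⊑a u◁v
    ... | inj₂ v⊑a = down a◁w v⊑a
    ... | inj₁ refl = ⊥-elim (v≢w (trans (sym (proj₁ u◁v)) (proj₁ a◁w)))

    towards-edge : ∀ {u v a b} → u ≢ w → v ≢ w → E T u v → Towards u a → Towards v b → a ≡ b
    towards-edge u≢w v≢w e ta tb with edge-◁ e
    ... | inj₁ u◁v = towards-unique (towards-parent v≢w u◁v ta) tb
    ... | inj₂ v◁u = towards-unique ta (towards-parent u≢w v◁u tb)

    -- The retraction of Plus onto the copy at w collapses each component of T - w
    -- to a point of the adhesion set it is attached to.
    data Retract : V⁺ → V (G (side w)) → Set where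
      here : ∀ {x} → Retract (w , x) x
      via  : ∀ {v x a} → v ≢ w → Towards v a → Retract (v , x) (base w a)

    retract : ∀ p → ∃ (Retract p)
    retract (v , x) with em {P = v ≡ w}
    ... | yes refl = x , here
    ... | no v≢w = _ , via v≢w (proj₂ (towards v≢w))

    retract-unique : ∀ {p y z} → Retract p y → Retract p z → y ≡ z
    retract-unique here here = refl
    retract-unique here (via w≢w _) = ⊥-elim (w≢w refl)
    retract-unique (via w≢w _) here = ⊥-elim (w≢w refl)
    retract-unique (via _ ta) (via _ tb) = cong (base w) (towards-unique ta tb)

    -- Edges inside the copy are kept, those leaving it become a move inside an adhesion set, and
    -- all others collapse; `suc D` covers both 1 and `D`.
    retract-edge : ∀ {p q y z} → E Plus p q → Retract p y → Retract q z →
                   Near (G (side w)) (suc D) y z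
    retract-edge (inj₁ (inner e)) here here = near-mono (s≤s z≤n) (near-edge e)
    retract-edge (inj₁ (inner e)) here (via w≢w _) = ⊥-elim (w≢w refl)
    retract-edge (inj₁ (inner e)) (via w≢w _) here = ⊥-elim (w≢w refl)
    retract-edge (inj₁ (inner e)) (via _ ta) (via _ tb)
      rewrite towards-unique ta tb = near-refl
    retract-edge (inj₂ (cross e e′ o x)) here here = ⊥-elim (E-irr T e)
    retract-edge (inj₂ (cross e e′ o x)) here (via _ t)
      rewrite towards-unique t (towards-neighbour (edge-◁ e)) =
        near-mono (n≤1+n D) (base-near e (adh-member A em x))
    retract-edge (inj₂ (cross e e′ o x)) (via _ t) here
      rewrite towards-unique t (towards-neighbour (edge-◁ e′)) =
        near-mono (n≤1+n D) (near-sym (base-near e′ (adh-member A em (φ o (label e) (label e′) x))))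
    retract-edge (inj₂ (cross e e′ o x)) (via u≢w ta) (via v≢w tb)
      rewrite towards-edge u≢w v≢w e ta tb = near-refl

    retract-walk : ∀ {n p q y z} → Walk Plus n p q → Retract p y → Retract q z →
                   Near (G (side w)) (n * suc D) y z
    retract-walk [] rp rq rewrite retract-unique rp rq = near-refl
    retract-walk (_∷_ {y = p₁} e walk) rp rq =
      near-trans (retract-edge e rp (proj₂ (retract p₁))) (retract-walk walk (proj₂ (retract p₁)) rq)

    retract-near : ∀ {r x y} → Near Plus r (w , x) (w , y) → Near (G (side w)) (r * suc D) x y
    retract-near (n , n≤r , walk) = near-mono (*-monoˡ-≤ (suc D) n≤r) (retract-walk walk here here)

  -- Links of a piece may use walks outside its copy. Retracting them costs a factor `suc D`, so the
  -- factors are coloured at scale `r * suc D`.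
  pieces-colourable : ∀ {n} → (∀ i → Colourable (G i) n) →
                      PiecesColourable em treeOfSpaces (Fin (suc n))
  pieces-colourable {n} col r = bound ① + bound ② , colour , bounded
    where
    bound : Side → ℕ
    bound i = proj₁ (col i (r * suc D))

    bound-≤ : ∀ i → bound i ≤ bound ① + bound ②
    bound-≤ ① = m≤m+n _ _
    bound-≤ ② = m≤n+m _ _

    colour : V⁺ → Fin (suc n)
    colour (v , x) = proj₁ (proj₂ (col (side v) (r * suc D))) x

    In : V T → Fin (suc n) → V⁺ → Set
    In w i p = proj₁ p ≡ w × colour p ≡ i

    project : ∀ {w i x q} → Star (Link Plus r (In w i)) (w , x) q →
              ∃[ y ] (q ≡ (w , y) ×
                Star (Link (G (side w)) (r * suc D) (λ y → colour (w , y) ≡ i)) x y)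
    project {x = x} ε = x , refl , ε
    project {w} (_◅_ {j = _ , _} ((_ , cx) , (refl , cy) , d) ls) with project ls
    ... | y , eq , ls′ = y , eq , (cx , cy , retract-near w d) ◅ ls′

    bounded : ∀ w i → Bounded Plus (bound ① + bound ②) r (In w i)
    bounded w i ε = near-refl
    bounded w i {_ , _} ls@(((refl , _) , _) ◅ _) with project ls
    ... | y , refl , ls′ =
          near-mono (bound-≤ (side w)) (near-copy (proj₂ (proj₂ (col (side w) (r * suc D))) i ls′))

-- Uniform bounds on adhesion sets

near-act : ∀ {Γ G} (α : Action Γ G) g {r x y} → Near G r x y →
           Near G r (Action._·_ α g x) (Action._·_ α g y)
near-act {G = G} α g (n , n≤r , w) = n , n≤r , act w
  where
  act : ∀ {n x y} → Walk G n x y → Walk G n (Action._·_ α g x) (Action._·_ α g y)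
  act [] = []
  act (e ∷ w) = Equivalence.to (Action.·-E α g) e ∷ act w

finite-diameter : ∀ {G} → Connected G → {P : Pred (V G) 0ℓ} → Finite P →
                  ∃[ D ] (∀ {x y} → P x → P y → Near G D x y)
finite-diameter {G} (o , joined) (xs , complete) =
  let D , near = radius xs in
  D + D , λ px py → near-trans (near-sym (near (complete _ px))) (near (complete _ py))
  where
  radius : ∀ xs → ∃[ D ] (∀ {x} → x ∈ xs → Near G D o x)
  radius [] = 0 , λ ()
  radius (x ∷ xs) with joined o x | radius xs
  ... | n , w | D , near = n + D , λ where
    (Any.here refl) → n , m≤m+n n D , w
    (Any.there x∈) → near-mono (m≤n+m D n) (near x∈)

module _ (em : ExcludedMiddle 0ℓ) (X : Side → ActedGraph)
         (A : TreeAmalgamation (ActedGraph.graph ∘ X))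
         (conn : ∀ i → Connected (ActedGraph.graph (X i)))
         (finite : TreeAmalgamation.FiniteAdhesion A) where
  open TreeAmalgamation A

  private
    DiameterAtMost : ℕ → ∀ {i} → I i → Set
    DiameterAtMost D {i} k = ∀ {x y} → S k x → S k y → Near (ActedGraph.graph (X i)) D x y

    Related : ∀ {i} → Rel (I i) 0ℓ
    Related {i} k k′ = ∃[ j ] Σ[ o ∈ Opposite j i ] Σ[ l ∈ I j ] ConsistentAt X A o l k k′

  φ-surjective : ∀ {i j} (o : Opposite i j) k l (y : Adh l) → ∃[ x ] φ o k l x ≡ y
  φ-surjective ①② k l y = φ ②① l k y , φ-inverse A ②① l k y
  φ-surjective ②① k l y = φ ①② l k y , φ-inverse A ①② l k y

  -- Both sets are images of the same `S l`, and consistency carries one to the other by a graph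
  -- automorphism.
  diameter-related : ∀ {i D} {k k′ : I i} → Related k k′ → DiameterAtMost D k′ → DiameterAtMost D k
  diameter-related {k = k} {k′} (j , o , l , γ , eq) diam {x} {y} sx sy
    with φ-surjective o l k (x , [ sx ]) | φ-surjective o l k (y , [ sy ])
  ... | x′ , refl | y′ , refl =
    subst₂ (Near _ _) (sym (eq x′)) (sym (eq y′))
      (near-act (ActedGraph.action (X _)) γ
        (diam (adh-member A em (φ o l k′ x′)) (adh-member A em (φ o l k′ y′))))

  class-diameter : ∀ {i} (Q : Pred (I i) 0ℓ) → (∀ {k k′} → Q k → Q k′ → Related k k′) →
                   ∃[ D ] (∀ {k} → Q k → DiameterAtMost D k)
  class-diameter {i} Q related with em {P = ∃ Q}
  ... | no none = 0 , λ q → ⊥-elim (none (_ , q))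
  ... | yes (k , q) =
        let D , diam = finite-diameter (conn i) (finite k) in
        D , λ q′ → diameter-related (related q′ q) diam

  diameter-mono : ∀ {D D′ i} {k : I i} → D ≤ D′ → DiameterAtMost D k → DiameterAtMost D′ k
  diameter-mono D≤D′ diam sx sy = near-mono D≤D′ (diam sx sy)

  adhesion-diameter : RespectsActions X A → ∃ (AdhesionDiameter A)
  adhesion-diameter (inj₁ (_ , consistent)) =
    D₁ + D₂ , λ e → bound (bipartite e) (label e) (label (E-sym T e))
    where
    -- Membership in the class is an opposite index `l`, as needed to compare two labels by
    -- consistency.
    class₁ = class-diameter {①} (λ _ → I ②) λ l _ → ② , ②① , l , consistent ②① _ _ _
    class₂ = class-diameter {②} (λ _ → I ①) λ l _ → ① , ①② , l , consistent ①② _ _ _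
    D₁ = proj₁ class₁
    D₂ = proj₁ class₂
    bound : ∀ {i j} → Opposite i j → (k : I i) → I j → DiameterAtMost (D₁ + D₂) k
    bound ①② k l = diameter-mono (m≤m+n D₁ D₂) (proj₂ class₁ l)
    bound ②① k l = diameter-mono (m≤n+m D₂ D₁) (proj₂ class₂ l)
  adhesion-diameter (inj₂ type2) =
    D₁ + D₂ + (D₃ + D₄) , λ e →
      bound (bipartite e) (label e) (label (E-sym T e)) (exactlyOne e (E-sym T e))
    where
    open Type2 type2
    -- One class for each side and each of `J` and its complement; the witness is an opposite index
    -- of the complementary kind, which `exactlyOne` provides for every edge.
    class₁ = class-diameter {①} (λ k → J k × ∃ (∁ J′)) λ (a , l , b) (a′ , _) →
               ② , ②① , l , consistent₁ ②① b a a′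
    class₂ = class-diameter {①} (λ k → ∁ J k × ∃ J′) λ (a , l , b) (a′ , _) →
               ② , ②① , l , consistent₂ ②① b a a′
    class₃ = class-diameter {②} (λ k → J′ k × ∃ (∁ J)) λ (a , l , b) (a′ , _) →
               ① , ①② , l , consistent₂ ①② b a a′
    class₄ = class-diameter {②} (λ k → ∁ J′ k × ∃ J) λ (a , l , b) (a′ , _) →
               ① , ①② , l , consistent₁ ①② b a a′
    D₁ = proj₁ class₁
    D₂ = proj₁ class₂
    D₃ = proj₁ class₃
    D₄ = proj₁ class₄
    bound : ∀ {i j} → Opposite i j → (k : I i) (l : I j) →
            onSides X A J J′ i k ⇔ (¬ onSides X A J J′ j l) →
            DiameterAtMost (D₁ + D₂ + (D₃ + D₄)) k
    bound ①② k l one with em {P = J k}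
    ... | yes a = diameter-mono (≤-trans (m≤m+n D₁ D₂) (m≤m+n _ _))
                    (proj₂ class₁ (a , l , Equivalence.to one a))
    ... | no ¬a = diameter-mono (≤-trans (m≤n+m D₂ D₁) (m≤m+n _ _))
                    (proj₂ class₂ (¬a , l , decidable-stable em (¬a ∘ Equivalence.from one)))
    bound ②① k l one with em {P = J′ k}
    ... | yes a = diameter-mono (≤-trans (m≤m+n D₃ D₄) (m≤n+m _ (D₁ + D₂)))
                    (proj₂ class₃ (a , l , Equivalence.to one a))
    ... | no ¬a = diameter-mono (≤-trans (m≤n+m D₄ D₃) (m≤n+m _ (D₁ + D₂)))
                    (proj₂ class₄ (¬a , l , decidable-stable em (¬a ∘ Equivalence.from one)))

-- Contracting the bonds

-- Pull the colouring back along the section: chains lift to scale `f r`, and their bound projects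
-- without loss.
colourable-image : ∀ {H K} (π : V H → V K) (section : V K → V H) → (∀ x → π (section x) ≡ x) →
                   (∀ {r p q} → Near H r p q → Near K r (π p) (π q)) →
                   (f : ℕ → ℕ) → (∀ {r p q} → Near K r (π p) (π q) → Near H (f r) p q) →
                   ∀ {n} → Colourable H n → Colourable K n
colourable-image {H} {K} π section inverse project f lift col r =
  let R , c , bounded = col (f r) in
  R , c ∘ section , λ i {x} {y} chain →
    subst₂ (Near K R) (inverse x) (inverse y) (project (bounded i (lift-chain c i chain)))
  where
  lift-chain : ∀ {n} (c : V H → Fin n) i {x y} → Star (Link K r (λ x → c (section x) ≡ i)) x y →
               Star (Link H (f r) (λ p → c p ≡ i)) (section x) (section y)
  lift-chain c i ε = ε
  lift-chain c i {x} (_◅_ {j = y} (cx , cy , d) ls) =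
    (cx , cy , lift (subst₂ (Near K r) (sym (inverse x)) (sym (inverse y)) d)) ◅ lift-chain c i ls

module _ (em : ExcludedMiddle 0ℓ) {G : Side → Graph} (A : TreeAmalgamation G) where
  open TreeAmalgamation A

  cross-edge : ∀ {p q} → Cross p q → E T (proj₁ p) (proj₁ q)
  cross-edge (cross e _ _ _) = e

  Bonds : Graph
  Bonds = record { V = V⁺ ; E = Cross ; E-sym = cross-sym A ; E-irr = E-irr T ∘ cross-edge }

  private
    φ-return : ∀ {i j} (o : Opposite i j) (o′ : Opposite j i) {k k′ : I i} {l l′ : I j} →
               k ≡ k′ → l ≡ l′ → (x : Adh k) (x′ : Adh l′) → value x′ ≡ value (φ o k l x) →
               value (φ o′ l′ k′ x′) ≡ value x
    φ-return ①② ②① {k} {l = l} refl refl x x′ eq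
      rewrite value-injective {v = x′} {φ ①② k l x} eq = cong value (φ-inverse A ①② k l x)
    φ-return ②① ①② {k} {l = l} refl refl x x′ eq
      rewrite value-injective {v = x′} {φ ②① k l x} eq = cong value (φ-inverse A ②① k l x)

    CrossView : Rel V⁺ 0ℓ
    CrossView (u , a) (v , b) = Σ[ e ∈ E T u v ] Σ[ e′ ∈ E T v u ] Σ[ o ∈ Opposite (side u) (side v) ]
      Σ[ x ∈ Adh (label e) ] (value x ≡ a × value (φ o (label e) (label e′) x) ≡ b)

    cross-view : ∀ {p q} → Cross p q → CrossView p q
    cross-view (cross e e′ o x) = e , e′ , o , x , refl , refl

  -- Labels do not depend on the edge proof, so the way back applies the inverse bonding map.
  cross-return : ∀ {p q s} → Cross p q → Cross q s → proj₁ p ≡ proj₁ s → p ≡ s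
  cross-return {u , a} {v , b} {_ , c} c₁ c₂ refl with cross-view c₁ | cross-view c₂
  ... | e , e′ , o , x , refl , eq | f , f′ , o′ , x′ , eq′ , refl =
    cong (u ,_) (sym (φ-return o o′ (label-irr e f′) (label-irr e′ f) x x′ (trans eq′ (sym eq))))

  -- By cross-return, a shortest walk along bonds runs over a walk of T without
  -- backtracking, hence over distinct nodes.
  bond-geodesic-short : ∀ {n p q} (w : Walk Bonds n p q) → (∀ m → Walk Bonds m p q → n ≤ m) →
                        ∀ xs → (∀ i → proj₁ (at w i) ∈ xs) → n < length xs
  bond-geodesic-short {n} w minimal xs listed = ≰⇒> crowded
    where
    backtrack : ∀ k → suc k < n → proj₁ (at w k) ≢ proj₁ (at w (2 + k))
    backtrack k k< eq =
      let l , l<n , w′ = shortcut w k k< (cross-return (at-edge w k (<⇒≤ k<)) (at-edge w (suc k) k<) eq)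
      in <⇒≱ l<n (minimal l w′)

    distinct : ∀ {i j} → i < j → j ≤ n → proj₁ (at w i) ≢ proj₁ (at w j)
    distinct = nonBacktracking-distinct (proj₂ tree)
      ((λ k k< → cross-edge (at-edge w k k<)) , backtrack)

    crowded : ¬ length xs ≤ n
    crowded len≤n with Finₚ.pigeonhole (s≤s len≤n) (λ i → Any.index (listed (toℕ i)))
    ... | i , j , i<j , eq = distinct i<j (≤-pred (Finₚ.toℕ<n j))
           (trans (Anyₚ.lookup-index (listed (toℕ i)))
             (trans (cong (lookup xs) eq) (sym (Anyₚ.lookup-index (listed (toℕ j))))))

  module _ (K : Graph) (π : V Plus → V K) (contraction : IsAmalgam A K π) where
    open IsContraction contraction

    cross-identified : ∀ {p q} → Cross p q → π p ≡ π q
    cross-identified c = Equivalence.from (identifies _ _) (fwd c ◅ ε)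

    bonds-walk : ∀ {p q} → EqClosure Cross p q → Joined Bonds p q
    bonds-walk ε = 0 , []
    bonds-walk (s ◅ ss) with bonds-walk ss
    ... | n , w = suc n , forward s ∷ w
      where
      forward : ∀ {p q} → SymClosure Cross p q → Cross p q
      forward (fwd c) = c
      forward (bwd c) = cross-sym A c

    Over : V K → Pred (V T) 0ℓ
    Over x u = ∃[ y ] (π (u , y) ≡ x)

    -- Bond walks within a fibre project to walks of `T` over `x`, so all nodes over `x` together
    -- form a subtree.
    over-Tₓ : ∀ x → IsTₓ A K π x (Over x)
    over-Tₓ x = ((point , joined) , λ u o → o) , λ Q sub _ → proj₂ sub _
      where
      point : V (T ⟨ Over x ⟩)
      point = let (u , y) , eq = surjective x in u , [ y , eq ]

      lift : ∀ {n p q} → Walk Bonds n p q → (eq : π p ≡ x) (eq′ : π q ≡ x) →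
             Walk (T ⟨ Over x ⟩) n (proj₁ p , [ proj₂ p , eq ]) (proj₁ q , [ proj₂ q , eq′ ])
      lift [] _ _ = []
      lift (c ∷ w) eq eq′ = cross-edge c ∷ lift w (trans (sym (cross-identified c)) eq) eq′

      joined : ∀ a b → Joined (T ⟨ Over x ⟩) a b
      joined (u , [ o ]) (v , [ o′ ]) =
        let (y , eq) = recompute em o ; (z , eq′) = recompute em o′
            n , w = bonds-walk (Equivalence.to (identifies (u , y) (v , z)) (trans eq (sym eq′)))
        in n , lift w eq eq′

    fibre-diameter : FiniteIdentification A K π → ∃[ m ] (∀ {p q} → π p ≡ π q → Near Plus m p q)
    fibre-diameter (m , atMost) = m , near
      where
      plus : ∀ {n p q} → Walk Bonds n p q → Walk Plus n p q
      plus [] = []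
      plus (c ∷ w) = inj₂ c ∷ plus w

      near : ∀ {p q} → π p ≡ π q → Near Plus m p q
      near {p} {q} πp≡πq
        with least em (λ n → Walk Bonds n p q) (bonds-walk (Equivalence.to (identifies p q) πp≡πq))
           | atMost (π p) (Over (π p)) (over-Tₓ (π p))
      ... | n , w , minimal | xs , len≤m , complete =
        n , ≤-trans (<⇒≤ (bond-geodesic-short w minimal xs listed)) len≤m , plus w
        where
        listed : ∀ i → proj₁ (at w i) ∈ xs
        listed i = complete _ (proj₂ (at w i) , at-preserves {P = λ s → π s ≡ π p}
                     (λ c eq → trans (sym (cross-identified c)) eq) w refl i)

    project-near : ∀ {r p q} → Near Plus r p q → Near K r (π p) (π q)
    project-near (n , n≤r , w) = near-mono n≤r (project w)
      where
      step : ∀ {p q} → E Plus p q → Near K 1 (π p) (π q)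
      step {p} {q} e with em {P = π p ≡ π q}
      ... | yes eq = subst (Near K 1 (π p)) eq near-refl
      ... | no neq = near-edge (Equivalence.from (adjacency _ _) (neq , p , q , e , refl , refl))
      project : ∀ {n p q} → Walk Plus n p q → Near K n (π p) (π q)
      project [] = near-refl
      project (e ∷ w) = near-trans (step e) (project w)

    -- Each edge of `K` costs a move within a fibre and one edge of `Plus`; the final `m` is the
    -- move in the last fibre.
    lift-near : ∀ m → (∀ {p q} → π p ≡ π q → Near Plus m p q) →
                ∀ {r p q} → Near K r (π p) (π q) → Near Plus (r * suc m + m) p q
    lift-near m fibre (n , n≤r , w) = near-mono (+-monoˡ-≤ m (*-monoˡ-≤ (suc m) n≤r)) (go w refl refl)
      where
      go : ∀ {n u v p q} → Walk K n u v → π p ≡ u → π q ≡ v → Near Plus (n * suc m + m) p q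
      go [] eq eq′ = fibre (trans eq (sym eq′))
      go {suc n} (e ∷ w) eq eq′ with Equivalence.to (adjacency _ _) e
      ... | _ , x , y , xy , πx , πy =
        near-mono (≤-reflexive (trans (+-suc m _) (sym (+-assoc (suc m) (n * suc m) m))))
          (near-trans (fibre (trans eq (sym πx))) (near-trans (near-edge xy) (go w πy eq′)))

    contract-colourable : FiniteIdentification A K π → ∀ {n} → Colourable Plus n → Colourable K n
    contract-colourable finite =
      let m , fibre = fibre-diameter finite in
      colourable-image π (proj₁ ∘ surjective) (proj₂ ∘ surjective) project-near
        (λ r → r * suc m + m) (lift-near m fibre)

-- Factorisations

obtained-colourable : ExcludedMiddle 0ℓ → ∀ {n m} {Gs : Fin m → Graph} →
                      (∀ i → Colourable (Gs i) (suc n)) →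
                      ∀ {is K} → Obtained Gs is K → Colourable K (suc n)
obtained-colourable em col (factor i) = col i
obtained-colourable em col (amalgam {K = K} X o₁ o₂ good A π contraction _ finite identification respects) =
  let conn = λ i → proj₁ (proj₂ (good i))
      D , diam = adhesion-diameter em X A conn finite respects
      open PlusTree em A conn diam
      parts = λ where
        ① → obtained-colourable em col o₁
        ② → obtained-colourable em col o₂
  in contract-colourable em A K π contraction identification
       (tree-colourable em treeOfSpaces (pieces-colourable parts))

module _ (em : ExcludedMiddle (Level.suc 0ℓ)) where

  asdim-≤ : ∀ M {n} → AsdimAtMost M n → asdimᴹ M em ≤⁺ [ n ]
  asdim-≤ M {n} asd with em {P = ∃ (AsdimAtMost M)}
  ... | yes ex = [ proj₂ (proj₂ (least em (AsdimAtMost M) ex)) n asd ]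
  ... | no none = ⊥-elim (none (n , asd))

  ≤-asdim : ∀ M {n} → asdimᴹ M em ≤⁺ [ n ] → AsdimAtMost M n
  ≤-asdim M le 𝒱 bdd with em {P = ∃ (AsdimAtMost M)} | le
  ... | yes ex | [ m≤n ] =
    let 𝒰 , bounded , mult , refines = proj₁ (proj₂ (least em (AsdimAtMost M) ex)) 𝒱 bdd in
    𝒰 , bounded , (λ x → let js , len , all = mult x in js , ≤-trans len (s≤s m≤n) , all) , refines

theorem1p2 : (em : ExcludedMiddle (Level.suc 0ℓ))
    (G : Graph) → LocallyFinite G → QuasiTransitive G → (conn : Connected G) →
    MoreThanOneEnd G →
    (n : ℕ) (Gs : Fin n → Graph) (fact : Factorisation G Gs) →
    asdim em G conn ≤⁺
    max [ 1 ] (tabulate λ i → asdim em (Gs i) (Factorisation.connected fact i))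
theorem1p2 em G _ _ conn _ n Gs fact = bound _ (⊥≤max [ 1 ] dims) (Allₚ.tabulate⁻ (xs≤max [ 1 ] dims))
  where
  em₀ = lowerEM em
  dims = tabulate λ i → asdim em (Gs i) (Factorisation.connected fact i)

  -- The maximum is generalised to `d` for the case distinction: infinity is trivial, and
  -- `[ 1 ] ≤⁺ d` leaves only positive numbers, hence at least two colours.
  bound : ∀ d → [ 1 ] ≤⁺ d → (∀ i → asdim em (Gs i) (Factorisation.connected fact i) ≤⁺ d) →
          asdim em G conn ≤⁺ d
  bound ⊤⁺ _ _ = _ ≤⊤⁺
  bound [ suc m ] [ _ ] le =
    asdim-≤ em (metric em₀ G conn) (colourable⇒asdim em₀ G conn
      (obtained-colourable em₀
        (λ i → asdim⇒colourable em₀ (Gs i) (Factorisation.connected fact i)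
                 (≤-asdim em (metric em₀ (Gs i) (Factorisation.connected fact i)) (le i)))
        (Factorisation.obtained fact)))
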